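{- For each $i\in\{1,2,3,4\}$ there exists a privacy measure $\mathcal{P}$ that satisfies all of Axioms 1, 2, 3, 4 except (possibly) Axiom $i$, and for which the following conclusion (that privacy implies differential privacy with polynomial overhead) fails: There exist a constant $C>0$ and a polynomial $q$ such that for all finite $X,Y$, all $n$, every $\mathcal{P}$-private algorithm $\mathcal{M}:X^n\to Y$, and all $\varepsilon,\delta,\beta\in(0,1)$, there are $m\le q(n,1/\varepsilon,\log(1/\delta),1/\beta)$ and an $(\varepsilon,\delta)$-differentially private algorithm $\mathcal{M}':X^m\to Y$ that is $(\beta,C\beta)$-equivalent to $\mathcal{M}$.
   Context: All domains $X$ and output spaces $Y$ are finite. An algorithm $\mathcal{M}:X^n\to Y$ may be randomized; $\mathcal{M}(S)$ denotes its (random) output on the dataset $S=(S_1,\dots,S_n)\in X^n$. Differential privacy: $\mathcal{M}:X^n\to Y$ is $(\varepsilon,\delta)$-differentially private (DP) if for all $S,S'\in X^n$ differing in only one of the $n$ coordinates and all $Y'\subseteq Y$, $\Pr[\mathcal{M}(S)\in Y']\le e^{\varepsilon}\Pr[\mathcal{M}(S')\in Y']+\delta$. Statistical task: given by a set $\mathscr{D}$ of distributions over $X$, an output space $Y$, and a map $\mathcal{T}$ from $\mathcal{D}\in\mathscr{D}$ to valid responses $\mathcal{T}(\mathcal{D})\subseteq Y$. $\mathcal{M}:X^n\to Y$ solves $\mathcal{T}$ with failure probability $\beta$ if for all $\mathcal{D}\in\mathscr{D}$, $\Pr_{S\sim\mathcal{D}^n}[\mathcal{M}(S)\in\mathcal{T}(\mathcal{D})]\ge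 1-\beta$. Equivalence: $\mathcal{M}':X^m\to Y$ is $(\beta,\beta')$-equivalent to $\mathcal{M}:X^n\to Y$ if every statistical task that $\mathcal{M}$ solves with failure probability $\beta$ is solved by $\mathcal{M}'$ with failure probability $\beta'$. Privacy measure: a map $\mathcal{P}$ assigning to every (possibly randomized) algorithm $\mathcal{M}:X^n\to Y$ (for all finite $X,Y$ and all $n$) a number $\mathcal{P}(\mathcal{M})\in\mathbb{R}_{\ge0}$. $\mathcal{M}$ is $\mathcal{P}$-private if $\mathcal{P}(\mathcal{M})\le 1$. Axiom 1 (preprocessing): (1) for every $\mathcal{M}:X^n\to Y$ and permutation $\pi$ of $[n]$, the algorithm $\mathcal{M}\circ\pi(S):=\mathcal{M}(S_{\pi(1)},\dots,S_{\pi(n)})$ has $\mathcal{P}(\mathcal{M}\circ\pi)\le\mathcal{P}(\mathcal{M})$; (2) for every $\mathcal{M}:X^n\to Y$ and every map $\sigma:X\to X$ (not necessarily a bijection), the algorithm $\mathcal{M}\circ\sigma(S):=\mathcal{M}(\sigma(S_1),\dots,\sigma(S_n))$ has $\mathcal{P}(\mathcal{M}\circ\sigma)\le\mathcal{P}(\mathcal{M})$. Axiom 2 (prohibits blatant non-privacy): no $\mathcal{P}$-private algorithm is blatantly non-private, where $\mathcal{M}:X^n\to Y$ is blatantly non-private if there are a distribution $\mathcal{D}$ on $X$ with $\mathcal{D}(x)\le 1/(100n^2)$ for all $x\in X$ and a (possibly randomized) adversary $A:Y\to X^n$ such that, for $S\sim\mathcal{D}^n$ and $S'\leftarrow A(\mathcal{M}(S))$,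 $\mathbb{E}\big[\sum_{x\in S}\mathbf{1}[x\in S']\big]\ge 0.9n$ (the sum ranges over the $n$ entries of $S$). Axiom 3 (strong composition): for some constant $c<1$, if $\mathcal{M}^1,\dots,\mathcal{M}^\ell:X^n\to Y$ all satisfy $\mathcal{P}(\mathcal{M}^i)\le\varepsilon$ and $\varepsilon':=\tilde O(\varepsilon\,\ell^c)=O(\varepsilon\,\ell^c\,\mathrm{polylog}(n))$ satisfies $\varepsilon'\le1$, then the composed algorithm $X^n\to Y^\ell$, $S\mapsto(\mathcal{M}^1(S),\dots,\mathcal{M}^\ell(S))$, is $\mathcal{P}$-private. (The implied constant and polylog depend only on $\mathcal{P}$.) Axiom 4 (linear scalability): for some polynomial $p:\mathbb{R}^2\to\mathbb{R}$, for every $\mathcal{P}$-private $\mathcal{M}:X^n\to Y$, every $\beta>0$ and every $k\ge p(n,1/\beta)$, there is an algorithm $\mathcal{M}'$ taking $m:=kn$ samples that is $(\beta,\beta')$-equivalent to $\mathcal{M}$ with $\beta'=O(\beta)$ and satisfies $\mathcal{P}(\mathcal{M}')\le O(1/k)$. (Implied constants depend only on $\mathcal{P}$.) -}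

module Defs where

open import Algebra.Bundles using (CommutativeRing)
import Algebra.Properties.Ring as RingProperties
import Algebra.Properties.CommutativeMonoid.Sum as CommutativeMonoidSum
import Algebra.Properties.Monoid.Mult as MonoidMult
import Algebra.Properties.Semiring.Exp as SemiringExp
import Algebra.Properties.Semiring.Sum as SemiringSum
open import Data.Bool.Base using (Bool; if_then_else_)
open import Data.Fin.Base using (Fin; zero; suc; _↑ˡ_; _↑ʳ_; combine)
import Data.Fin.Properties as Fin
open import Data.Fin.Patterns using (0F; 1F; 2F; 3F)
open import Data.Fin.Permutation using (Permutation′; _⟨$⟩ʳ_)
open import Data.List.Base as List using (List)
open import Data.Nat.Base as ℕ using (ℕ; zero; suc; NonZero)
open import Data.Product.Base using (∃; ∃-syntax; _×_; _,_; proj₁; proj₂; uncurry)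
open import Data.Product.Function.NonDependent.Propositional using (_×-↔_)
open import Data.Sum.Base using (inj₁; inj₂)
open import Data.Vec.Base as Vec using (Vec; []; _∷_; lookup)
import Data.Vec.Membership.DecPropositional as DecMembership
open import Function.Base using (_∘_)
open import Function.Bundles using (_↔_; mk↔ₛ′; Inverse)
open import Function.Construct.Composition using (_↔-∘_)
open import Function.Construct.Symmetry using (↔-sym)
open import Function.Properties.Inverse using (↔⇒↣)
open import Level using (0ℓ) renaming (suc to lsuc)
open import Relation.Binary.Core using (Rel)
open import Relation.Binary.Definitions using (DecidableEquality)
open import Relation.Binary.PropositionalEquality as ≡ using (_≡_; _≢_)
import Relation.Binary.Construct.NonStrictToStrict as NonStrictToStrict
open import Relation.Binary.Structures using (IsTotalOrder)
import Relation.Binary.Reasoning.Setoid as SetoidReasoning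
open import Relation.Nullary using (¬_)
open import Relation.Nullary.Decidable using (does; via-injection)

-- The real numbers as a complete ordered field.  Such a field is unique up to
-- isomorphism, and the conditions on exp and log (the latter on positive
-- arguments only) leave no choice for them: a homomorphism f from (ℝ,+) to
-- (ℝ,*) with 1 + x ≤ f x satisfies (1 + x/n)ⁿ ≤ f x ≤ (1 - x/n)⁻ⁿ for all
-- large n, so f x = eˣ.
record RealNumbers : Set (lsuc 0ℓ) where
  infix 4 _≤_
  infix 8 _⁻¹
  field
    commutativeRing : CommutativeRing 0ℓ 0ℓ

  open CommutativeRing commutativeRing public
    using (_≈_; _+_; _*_; -_; _-_; 0#; 1#; semiring; *-commutativeMonoid; setoid)
    renaming (Carrier to ℝ)

  field
    -- The value of 0# ⁻¹ is left unspecified.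
    _⁻¹       : ℝ → ℝ
    ⁻¹-cong   : ∀ {x y} → x ≈ y → x ⁻¹ ≈ y ⁻¹
    *-inverse : ∀ {x} → ¬ (x ≈ 0#) → x * x ⁻¹ ≈ 1#
    1≉0       : ¬ (1# ≈ 0#)

    _≤_          : Rel ℝ 0ℓ
    isTotalOrder : IsTotalOrder _≈_ _≤_
    +-monoˡ-≤    : ∀ {x y} z → x ≤ y → x + z ≤ y + z
    *-nonneg     : ∀ {x y} → 0# ≤ x → 0# ≤ y → 0# ≤ x * y

    supremum : (A : ℝ → Set) → ∃ A → (∃[ b ] ∀ x → A x → x ≤ b) →
               ∃[ s ] (∀ x → A x → x ≤ s) × (∀ b → (∀ x → A x → x ≤ b) → s ≤ b)

  infix 4 _<_
  _<_ : Rel ℝ 0ℓ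
  _<_ = NonStrictToStrict._<_ _≈_ _≤_

  field
    exp      : ℝ → ℝ
    exp-cong : ∀ {x y} → x ≈ y → exp x ≈ exp y
    exp-+    : ∀ x y → exp (x + y) ≈ exp x * exp y
    1+x≤exp  : ∀ x → 1# + x ≤ exp x

    log     : ℝ → ℝ
    exp-log : ∀ {x} → 0# < x → exp (log x) ≈ x

  open SemiringExp semiring public using (_^_)
  open SemiringSum semiring public using (sum)
  open CommutativeMonoidSum *-commutativeMonoid public using () renaming (sum to product)

  fromℕ : ℕ → ℝ
  fromℕ n = MonoidMult._×_ (CommutativeRing.+-monoid commutativeRing) n 1#

  -- x ^ʳ c is meaningful for 0# < x only.
  infixr 8 _^ʳ_
  _^ʳ_ : ℝ → ℝ → ℝ
  x ^ʳ c = exp (c * log x)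

-- The choice of bijection carries no meaning; PrivacyMeasure.cong below makes
-- sure that nothing can depend on it.
record FinSet : Set (lsuc 0ℓ) where
  constructor finSet
  field
    Carrier     : Set
    {size}      : ℕ
    enumeration : Carrier ↔ Fin size

  element : Fin size → Carrier
  element = Inverse.from enumeration

  infix 4 _≟_
  _≟_ : DecidableEquality Carrier
  _≟_ = via-injection (↔⇒↣ enumeration) Fin._≟_

open FinSet public using (Carrier)

∣_∣ᶠ : FinSet → ℕ
∣_∣ᶠ = FinSet.size

Vec-zero↔ : {A : Set} → Vec A 0 ↔ Fin 1
Vec-zero↔ = mk↔ₛ′ (λ _ → zero) (λ _ → []) (λ { zero → ≡.refl }) (λ { [] → ≡.refl })

Vec-suc↔ : {A : Set} {n : ℕ} → Vec A (suc n) ↔ (A × Vec A n)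
Vec-suc↔ = mk↔ₛ′ (λ { (x ∷ xs) → x , xs }) (uncurry _∷_)
                 (λ _ → ≡.refl) (λ { (_ ∷ _) → ≡.refl })

Vec↔ : {A : Set} {k : ℕ} → A ↔ Fin k → ∀ n → Vec A n ↔ Fin (k ℕ.^ n)
Vec↔ e zero    = Vec-zero↔
Vec↔ e (suc n) = ↔-sym Fin.*↔× ↔-∘ ((e ×-↔ Vec↔ e n) ↔-∘ Vec-suc↔)

infix 9 _^ᶠ_
_^ᶠ_ : FinSet → ℕ → FinSet
X ^ᶠ n = finSet (Vec (Carrier X) n) (Vec↔ (FinSet.enumeration X) n)

-- Excluded middle makes every subset of this form.
Subset : FinSet → Set
Subset Y = Carrier Y → Bool

module _ (R : RealNumbers) where
  open RealNumbers R

  Σᶠ : (X : FinSet) → (Carrier X → ℝ) → ℝ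
  Σᶠ X f = sum (f ∘ FinSet.element X)

  𝟙 : Bool → ℝ
  𝟙 b = if b then 1# else 0#

  record Distribution (X : FinSet) : Set where
    field
      prob    : Carrier X → ℝ
      nonneg  : ∀ x → 0# ≤ prob x
      total≈1 : Σᶠ X prob ≈ 1#

  open Distribution public using (prob)

  infix 4 _≐_
  _≐_ : {X : FinSet} → Rel (Distribution X) 0ℓ
  _≐_ {X} D D′ = ∀ (x : Carrier X) → prob D x ≈ prob D′ x

  𝔼 : {X : FinSet} → Distribution X → (Carrier X → ℝ) → ℝ
  𝔼 {X} D f = Σᶠ X (λ x → prob D x * f x)

  Pr : {X : FinSet} → Distribution X → Subset X → ℝ
  Pr D A = 𝔼 D (𝟙 ∘ A)

  private
    module ℛ = CommutativeRing commutativeRing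
    module ≤ᵣ = IsTotalOrder isTotalOrder
    open RingProperties ℛ.ring using (-1*x≈-x; -‿involutive)
    open SemiringSum semiring using (sum-cong-≋; *-distribˡ-sum; *-distribʳ-sum)

  sum-++ : ∀ m {n} (f : Fin (m ℕ.+ n) → ℝ) →
           sum f ≈ sum (λ i → f (i ↑ˡ n)) + sum (λ j → f (m ↑ʳ j))
  sum-++ zero    f = ℛ.sym (ℛ.+-identityˡ _)
  sum-++ (suc m) f = ℛ.trans (ℛ.+-congˡ (sum-++ m (f ∘ suc))) (ℛ.sym (ℛ.+-assoc _ _ _))

  sum-combine : ∀ m {n} (f : Fin (m ℕ.* n) → ℝ) →
                sum f ≈ sum (λ (i : Fin m) → sum (λ (j : Fin n) → f (combine i j)))
  sum-combine zero        f = ℛ.refl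
  sum-combine (suc m) {n} f =
    ℛ.trans (sum-++ n f) (ℛ.+-congˡ (sum-combine m (f ∘ (n ↑ʳ_))))

  0≤1 : 0# ≤ 1#
  0≤1 with ≤ᵣ.total 0# 1#
  ... | inj₁ p = p
  ... | inj₂ p = ≤ᵣ.trans (*-nonneg 0≤-1 0≤-1) (≤ᵣ.reflexive -1*-1≈1)
    where
    0≤-1 : 0# ≤ - 1#
    0≤-1 = ≤ᵣ.trans (≤ᵣ.reflexive (ℛ.sym (ℛ.-‿inverseʳ 1#)))
             (≤ᵣ.trans (+-monoˡ-≤ (- 1#) p) (≤ᵣ.reflexive (ℛ.+-identityˡ _)))
    -1*-1≈1 : - 1# * - 1# ≈ 1#
    -1*-1≈1 = ℛ.trans (-1*x≈-x (- 1#)) (-‿involutive 1#)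

  Σᶠ-∷ : ∀ (X : FinSet) n (f : Vec (Carrier X) (suc n) → ℝ) →
         Σᶠ (X ^ᶠ suc n) f ≈ Σᶠ X (λ x → Σᶠ (X ^ᶠ n) (λ xs → f (x ∷ xs)))
  Σᶠ-∷ X n f = ℛ.trans (sum-combine ∣ X ∣ᶠ (f ∘ FinSet.element (X ^ᶠ suc n)))
    (sum-cong-≋ λ i → sum-cong-≋ λ j → ℛ.reflexive (≡.cong
      (λ ij → f (FinSet.element X (proj₁ ij) ∷ FinSet.element (X ^ᶠ n) (proj₂ ij)))
      (Fin.remQuot-combine i j)))

  ∏-prob : {X : FinSet} {n : ℕ} → (Fin n → Distribution X) → Vec (Carrier X) n → ℝ
  ∏-prob D xs = product (λ i → prob (D i) (lookup xs i))

  ∏-nonneg : ∀ {X n} (D : Fin n → Distribution X) xs → 0# ≤ ∏-prob D xs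
  ∏-nonneg D []       = 0≤1
  ∏-nonneg D (x ∷ xs) = *-nonneg (Distribution.nonneg (D zero) x) (∏-nonneg (D ∘ suc) xs)

  ∏-total≈1 : ∀ {X n} (D : Fin n → Distribution X) → Σᶠ (X ^ᶠ n) (∏-prob D) ≈ 1#
  ∏-total≈1 {X} {zero}  D = ℛ.+-identityʳ 1#
  ∏-total≈1 {X} {suc n} D = begin
    Σᶠ (X ^ᶠ suc n) (∏-prob D)
      ≈⟨ Σᶠ-∷ X n (∏-prob D) ⟩
    Σᶠ X (λ x → Σᶠ (X ^ᶠ n) (λ xs → prob (D zero) x * ∏-prob (D ∘ suc) xs))
      ≈⟨ sum-cong-≋ (λ i → ℛ.sym (*-distribˡ-sum (prob (D zero) (FinSet.element X i))
                                  (∏-prob (D ∘ suc) ∘ FinSet.element (X ^ᶠ n)))) ⟩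
    Σᶠ X (λ x → prob (D zero) x * Σᶠ (X ^ᶠ n) (∏-prob (D ∘ suc)))
      ≈⟨ *-distribʳ-sum (Σᶠ (X ^ᶠ n) (∏-prob (D ∘ suc))) (prob (D zero) ∘ FinSet.element X) ⟨
    Σᶠ X (prob (D zero)) * Σᶠ (X ^ᶠ n) (∏-prob (D ∘ suc))
      ≈⟨ ℛ.*-cong (Distribution.total≈1 (D zero)) (∏-total≈1 (D ∘ suc)) ⟩
    1# * 1#
      ≈⟨ ℛ.*-identityˡ 1# ⟩
    1# ∎
    where open SetoidReasoning setoid

  independent : {X : FinSet} {n : ℕ} → (Fin n → Distribution X) → Distribution (X ^ᶠ n)
  independent D = record { prob = ∏-prob D ; nonneg = ∏-nonneg D ; total≈1 = ∏-total≈1 D }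

  iid : {X : FinSet} → Distribution X → (n : ℕ) → Distribution (X ^ᶠ n)
  iid D n = independent {n = n} (λ _ → D)

  record Algorithm (X : FinSet) (n : ℕ) (Y : FinSet) : Set where
    constructor algorithm
    field
      run : Vec (Carrier X) n → Distribution Y

  open Algorithm public using (run)

  Neighbours : {A : Set} {n : ℕ} → Rel (Vec A n) 0ℓ
  Neighbours S S′ = ∃[ i ] (∀ j → j ≢ i → lookup S j ≡ lookup S′ j)

  DifferentiallyPrivate : ∀ {X n Y} → ℝ → ℝ → Algorithm X n Y → Set
  DifferentiallyPrivate {Y = Y} ε δ M = ∀ S S′ → Neighbours S S′ → (Y′ : Subset Y) →
    Pr (run M S) Y′ ≤ exp ε * Pr (run M S′) Y′ + δ

  record StatisticalTask (X Y : FinSet) : Set (lsuc 0ℓ) where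
    field
      𝒟      : Distribution X → Set
      𝒟-resp : ∀ {D D′} → D ≐ D′ → 𝒟 D → 𝒟 D′
      𝒯      : ∀ D → 𝒟 D → Subset Y
      𝒯-cong : ∀ {D D′} → D ≐ D′ → (d : 𝒟 D) (d′ : 𝒟 D′) → ∀ y → 𝒯 D d y ≡ 𝒯 D′ d′ y

  Solves : ∀ {X n Y} → Algorithm X n Y → StatisticalTask X Y → ℝ → Set
  Solves {n = n} M t β = ∀ D (d : 𝒟 D) → 1# - β ≤ 𝔼 (iid D n) (λ S → Pr (run M S) (𝒯 D d))
    where open StatisticalTask t

  Equivalent : ∀ {X m n Y} → ℝ → ℝ → Algorithm X m Y → Algorithm X n Y → Set (lsuc 0ℓ)
  Equivalent {X} {Y = Y} β β′ M′ M =
    (t : StatisticalTask X Y) → Solves M t β → Solves M′ t β′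

  record PrivacyMeasure : Set (lsuc 0ℓ) where
    field
      μ      : ∀ {X n Y} → Algorithm X n Y → ℝ
      nonneg : ∀ {X n Y} (M : Algorithm X n Y) → 0# ≤ μ M
      cong   : ∀ {A B : Set} {k k′ l l′} {eA : A ↔ Fin k} {eA′ : A ↔ Fin k′}
               {eB : B ↔ Fin l} {eB′ : B ↔ Fin l′} {n}
               (M  : Algorithm (finSet A eA)  n (finSet B eB))
               (M′ : Algorithm (finSet A eA′) n (finSet B eB′)) →
               (∀ S y → prob (run M S) y ≈ prob (run M′ S) y) → μ M ≈ μ M′

    Private : ∀ {X n Y} → Algorithm X n Y → Set
    Private M = μ M ≤ 1#

  permuteInput : ∀ {X n Y} → Permutation′ n → Algorithm X n Y → Algorithm X n Y
  permuteInput π M = algorithm λ S → run M (Vec.tabulate (λ i → lookup S (π ⟨$⟩ʳ i)))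

  mapInput : ∀ {X n Y} → (Carrier X → Carrier X) → Algorithm X n Y → Algorithm X n Y
  mapInput σ M = algorithm λ S → run M (Vec.map σ S)

  compose : ∀ {X n Y ℓ} → (Fin ℓ → Algorithm X n Y) → Algorithm X n (Y ^ᶠ ℓ)
  compose M = algorithm λ S → independent (λ i → run (M i) S)

  recovered : (X : FinSet) {n : ℕ} → Vec (Carrier X) n → Vec (Carrier X) n → ℝ
  recovered X S S′ = sum (λ i → 𝟙 (does (lookup S i ∈? S′)))
    where open DecMembership (FinSet._≟_ X) using (_∈?_)

  BlatantlyNonPrivate : ∀ {X n Y} → Algorithm X n Y → Set
  BlatantlyNonPrivate {X} {n} {Y} M =
    ∃ λ (D : Distribution X) → (∀ x → prob D x ≤ fromℕ (100 ℕ.* n ℕ.^ 2) ⁻¹) ×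
    ∃ λ (A : Carrier Y → Distribution (X ^ᶠ n)) →
      fromℕ 9 * fromℕ 10 ⁻¹ * fromℕ n ≤
        𝔼 (iid D n) (λ S → 𝔼 (run M S) (λ y → 𝔼 (A y) (λ S′ → recovered X S S′)))

  -- A polynomial is a list of monomials, each a coefficient with exponents.
  Polynomial : ℕ → Set
  Polynomial k = List (ℝ × Vec ℕ k)

  ⟦_⟧ : ∀ {k} → Polynomial k → Vec ℝ k → ℝ
  ⟦ q ⟧ xs = List.foldr (λ (c , es) r → c * product (λ i → lookup xs i ^ lookup es i) + r) 0# q

  module _ (P : PrivacyMeasure) where
    open PrivacyMeasure P

    Preprocessing : Set (lsuc 0ℓ)
    Preprocessing =
      (∀ {X n Y} (M : Algorithm X n Y) (π : Permutation′ n) → μ (permuteInput π M) ≤ μ M) ×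
      (∀ {X n Y} (M : Algorithm X n Y) (σ : Carrier X → Carrier X) → μ (mapInput σ M) ≤ μ M)

    -- The bound 1/(100n²) presupposes n ≥ 1.
    NoBlatantNonPrivacy : Set (lsuc 0ℓ)
    NoBlatantNonPrivacy = ∀ {X n Y} .{{_ : NonZero n}} (M : Algorithm X n Y) →
      Private M → ¬ BlatantlyNonPrivate M

    -- polylog(n) is rendered as a power of log (n + 2): log n itself would
    -- make the composition bound vanish at n = 1.
    StrongComposition : Set (lsuc 0ℓ)
    StrongComposition =
      ∃[ c ] c < 1# × ∃[ K ] 0# < K × ∃[ a ]
      (∀ {X n Y ℓ} .{{_ : NonZero ℓ}} (M : Fin ℓ → Algorithm X n Y) (ε : ℝ) →
        (∀ i → μ (M i) ≤ ε) →
        K * (ε * fromℕ ℓ ^ʳ c * log (fromℕ (n ℕ.+ 2)) ^ a) ≤ 1# →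
        Private (compose M))

    LinearScalability : Set (lsuc 0ℓ)
    LinearScalability =
      ∃[ p ] ∃[ K₁ ] 0# < K₁ × ∃[ K₂ ] 0# < K₂ ×
      (∀ {X n Y} (M : Algorithm X n Y) → Private M → ∀ β → 0# < β →
        ∀ k .{{_ : NonZero k}} → ⟦ p ⟧ (fromℕ n ∷ β ⁻¹ ∷ []) ≤ fromℕ k →
        ∃[ M′ ] Equivalent {m = k ℕ.* n} β (K₁ * β) M′ M × μ M′ ≤ K₂ * fromℕ k ⁻¹)

    Axiom : Fin 4 → Set (lsuc 0ℓ)
    Axiom 0F = Preprocessing
    Axiom 1F = NoBlatantNonPrivacy
    Axiom 2F = StrongComposition
    Axiom 3F = LinearScalability

    0<_<1 : ℝ → Set
    0< x <1 = 0# < x × x < 1#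

    PrivacyImpliesDP : Set (lsuc 0ℓ)
    PrivacyImpliesDP =
      ∃[ C ] 0# < C × ∃[ q ]
      (∀ {X n Y} (M : Algorithm X n Y) → Private M →
        ∀ ε δ β → 0< ε <1 → 0< δ <1 → 0< β <1 →
        ∃[ m ] fromℕ m ≤ ⟦ q ⟧ (fromℕ n ∷ ε ⁻¹ ∷ log (δ ⁻¹) ∷ β ⁻¹ ∷ []) ×
        ∃[ M′ ] DifferentiallyPrivate ε δ M′ × Equivalent {m = m} β (C * β) M′ M)

{-# OPTIONS --safe #-}
-- Returning the first of two samples solves the task "output an element of the
-- support".  A differentially private algorithm with m samples does not: on the
-- uniform distribution over the graph of a random b : [N] → [N], it outputs one
-- of its samples with probability at most m (e^ε/N + δ), and outputs any other
-- point of the graph with probability at most 1/N, since the samples say nothing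
-- about the other values of b.  The sample bound q is fixed before N, and is
-- polynomial in log (1/δ), so both terms vanish for small δ and large N.
--
-- Hence any privacy measure that declares this algorithm private will do:
--   1. measure 0 if the output depends on the first of n ≥ 2 entries only;
--   2. measure 0 for every algorithm;
--   3. measure 0 if the output depends on some single one of n ≥ 2 entries;
--   4. as in 3, but with measure 1 instead of 0;
-- where every other algorithm gets measure 2.  An algorithm that reads a single
-- entry recovers the others only by chance, so it is not blatantly non-private
-- when n ≥ 2, and it scales to kn samples by ignoring all but the first n.
module Submission where

open import Defs
open import Algebra.Bundles using (CommutativeRing)
import Algebra.Properties.CommutativeMonoid.Sum as CommutativeMonoidSum
import Algebra.Properties.CommutativeSemiring.Exp as CommutativeSemiringExp
import Algebra.Properties.Monoid.Mult as MonoidMult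
import Algebra.Properties.Semiring.Exp as SemiringExp
import Algebra.Properties.Semiring.Mult as SemiringMult
import Algebra.Properties.Semiring.Sum as SemiringSum
import Algebra.Solver.Ring.NaturalCoefficients.Default as NaturalCoefficients
open import Axiom.ExcludedMiddle using (ExcludedMiddle)
open import Data.Bool.Base using (true; false; if_then_else_)
open import Data.Empty using (⊥)
open import Data.Fin.Base using (Fin; zero; suc; _↑ˡ_; toℕ)
open import Data.Fin.Patterns using (0F; 1F; 2F; 3F)
open import Data.Fin.Permutation using (_⟨$⟩ʳ_)
import Data.Fin.Properties as Fin
open import Data.List.Base using ([]; _∷_)
open import Data.Nat.Base as ℕ using (ℕ; zero; suc; NonZero)
import Data.Nat.Properties as ℕ
open import Data.Product.Base using (_×_; ∃-syntax; _,_; proj₁; proj₂)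
open import Data.Sum.Base using (inj₁; inj₂)
open import Data.Unit.Base using (⊤)
open import Data.Vec.Base as Vec using (Vec; []; _∷_; lookup; _[_]≔_)
import Data.Vec.Membership.DecPropositional as DecMembership
open import Data.Vec.Properties
  using (lookup∘update; lookup∘update′; lookup-++ˡ; take++drop≡id; lookup∘tabulate; lookup-map)
open import Data.Vec.Relation.Unary.Any using (here; there; index)
open import Data.Vec.Relation.Unary.Any.Properties using (lookup-index)
open import Function.Base using (_∘_)
open import Function.Bundles using (Inverse; mk⇔)
open import Function.Construct.Identity using (↔-id)
open import Function.Construct.Symmetry using (↔-sym)
open import Level as Level using (0ℓ; lift; lower)
open import Relation.Binary.Bundles using (Poset)
import Relation.Binary.Construct.NonStrictToStrict as NonStrictToStrict
open import Relation.Binary.PropositionalEquality as ≡ using (_≡_; _≢_)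
import Relation.Binary.Reasoning.PartialOrder as PartialOrderReasoning
open import Relation.Binary.Structures using (IsTotalOrder)
open import Relation.Nullary using (¬_; Dec; yes; no; does; contradiction)
open import Relation.Nullary.Decidable using (decidable-stable; dec-true; dec-false; does-⇔; map′)

-- Arithmetic of the ordered field and the Archimedean property.

module OrderedField (R : RealNumbers) where
  open RealNumbers R
  module ℛ = CommutativeRing commutativeRing
  module Ord = IsTotalOrder isTotalOrder

  poset : Poset 0ℓ 0ℓ 0ℓ
  poset = record { isPartialOrder = Ord.isPartialOrder }

  module ≤-Reasoning = PartialOrderReasoning poset
  open ≤-Reasoning

  0<1 : 0# < 1#
  0<1 = 0≤1 R , λ eq → 1≉0 (ℛ.sym eq)

  +-monoʳ-≤ : ∀ {x y} z → x ≤ y → z + x ≤ z + y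
  +-monoʳ-≤ {x} {y} z x≤y = begin
    z + x ≈⟨ ℛ.+-comm z x ⟩
    x + z ≤⟨ +-monoˡ-≤ z x≤y ⟩
    y + z ≈⟨ ℛ.+-comm y z ⟩
    z + y ∎

  +-mono-≤ : ∀ {x y u v} → x ≤ y → u ≤ v → x + u ≤ y + v
  +-mono-≤ {y = y} {u} x≤y u≤v = Ord.trans (+-monoˡ-≤ u x≤y) (+-monoʳ-≤ y u≤v)

  +-cancelʳ-≤ : ∀ {x y} z → x + z ≤ y + z → x ≤ y
  +-cancelʳ-≤ {x} {y} z le = begin
    x               ≈⟨ cancel x ⟨
    x + z + - z     ≤⟨ +-monoˡ-≤ (- z) le ⟩
    y + z + - z     ≈⟨ cancel y ⟩
    y               ∎
    where
    cancel : ∀ w → w + z + - z ≈ w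
    cancel w = ℛ.trans (ℛ.+-assoc w z (- z))
                 (ℛ.trans (ℛ.+-congˡ (ℛ.-‿inverseʳ z)) (ℛ.+-identityʳ w))

  x-y+y≈x : ∀ x y → x - y + y ≈ x
  x-y+y≈x x y = ℛ.trans (ℛ.+-assoc x (- y) y)
                  (ℛ.trans (ℛ.+-congˡ (ℛ.-‿inverseˡ y)) (ℛ.+-identityʳ x))

  +-monoˡ-< : ∀ {x y} z → x < y → x + z < y + z
  +-monoˡ-< z (x≤y , x≉y) =
    +-monoˡ-≤ z x≤y ,
    λ eq → x≉y (Ord.antisym x≤y (+-cancelʳ-≤ z (Ord.reflexive (ℛ.sym eq))))

  +-mono-<-≤ : ∀ {x y u v} → x < y → u ≤ v → x + u < y + v
  +-mono-<-≤ {x} {y} {u} {v} x<y u≤v = begin-strict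
    x + u <⟨ +-monoˡ-< u x<y ⟩
    y + u ≤⟨ +-monoʳ-≤ y u≤v ⟩
    y + v ∎

  +-nonneg : ∀ {x y} → 0# ≤ x → 0# ≤ y → 0# ≤ x + y
  +-nonneg {x} {y} 0≤x 0≤y = begin
    0#      ≈⟨ ℛ.+-identityʳ 0# ⟨
    0# + 0# ≤⟨ +-mono-≤ 0≤x 0≤y ⟩
    x + y   ∎

  x≤x+y : ∀ {x y} → 0# ≤ y → x ≤ x + y
  x≤x+y {x} {y} 0≤y = begin
    x      ≈⟨ ℛ.+-identityʳ x ⟨
    x + 0# ≤⟨ +-monoʳ-≤ x 0≤y ⟩
    x + y  ∎

  y≤x+y : ∀ {x y} → 0# ≤ x → y ≤ x + y
  y≤x+y {x} {y} 0≤x = Ord.trans (x≤x+y 0≤x) (Ord.reflexive (ℛ.+-comm y x))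

  *-monoˡ-≤ : ∀ {x y} z → 0# ≤ z → x ≤ y → z * x ≤ z * y
  *-monoˡ-≤ {x} {y} z 0≤z x≤y = begin
    z * x               ≈⟨ ℛ.+-identityˡ _ ⟨
    0# + z * x          ≤⟨ +-monoˡ-≤ (z * x) (*-nonneg 0≤z 0≤y-x) ⟩
    z * (y - x) + z * x ≈⟨ ℛ.distribˡ z (y - x) x ⟨
    z * (y - x + x)     ≈⟨ ℛ.*-congˡ (x-y+y≈x y x) ⟩
    z * y               ∎
    where
    0≤y-x : 0# ≤ y - x
    0≤y-x = begin
      0#    ≈⟨ ℛ.-‿inverseʳ x ⟨
      x - x ≤⟨ +-monoˡ-≤ (- x) x≤y ⟩
      y - x ∎

  *-monoʳ-≤ : ∀ {x y} z → 0# ≤ z → x ≤ y → x * z ≤ y * z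
  *-monoʳ-≤ {x} {y} z 0≤z x≤y = begin
    x * z ≈⟨ ℛ.*-comm x z ⟩
    z * x ≤⟨ *-monoˡ-≤ z 0≤z x≤y ⟩
    z * y ≈⟨ ℛ.*-comm z y ⟩
    y * z ∎

  *-mono-≤ : ∀ {x y u v} → 0# ≤ u → 0# ≤ y → x ≤ y → u ≤ v → x * u ≤ y * v
  *-mono-≤ {x} {y} {u} {v} 0≤u 0≤y x≤y u≤v = begin
    x * u ≤⟨ *-monoʳ-≤ u 0≤u x≤y ⟩
    y * u ≤⟨ *-monoˡ-≤ y 0≤y u≤v ⟩
    y * v ∎

  0<⇒≉0 : ∀ {x} → 0# < x → ¬ (x ≈ 0#)
  0<⇒≉0 (_ , 0≉x) x≈0 = 0≉x (ℛ.sym x≈0)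

  *-inverseˡ : ∀ {x} → 0# < x → x ⁻¹ * x ≈ 1#
  *-inverseˡ 0<x = ℛ.trans (ℛ.*-comm _ _) (*-inverse (0<⇒≉0 0<x))

  ⁻¹-pos : ∀ {x} → 0# < x → 0# < x ⁻¹
  ⁻¹-pos {x} 0<x = 0≤x⁻¹ , λ 0≈x⁻¹ → 1≉0 (begin-equality
      1#       ≈⟨ *-inverse (0<⇒≉0 0<x) ⟨
      x * x ⁻¹ ≈⟨ ℛ.*-congˡ 0≈x⁻¹ ⟨
      x * 0#   ≈⟨ ℛ.zeroʳ x ⟩
      0#       ∎)
    where
    0≤x⁻¹ : 0# ≤ x ⁻¹
    0≤x⁻¹ with Ord.total 0# (x ⁻¹)
    ... | inj₁ p = p
    ... | inj₂ p = contradiction (Ord.antisym (begin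
      1#       ≈⟨ *-inverse (0<⇒≉0 0<x) ⟨
      x * x ⁻¹ ≤⟨ *-monoˡ-≤ x (proj₁ 0<x) p ⟩
      x * 0#   ≈⟨ ℛ.zeroʳ x ⟩
      0#       ∎) (0≤1 R)) 1≉0

  *-cancelˡ-≤ : ∀ {x y} z → 0# < z → z * x ≤ z * y → x ≤ y
  *-cancelˡ-≤ {x} {y} z 0<z le = begin
    x            ≈⟨ cancel x ⟨
    z ⁻¹ * (z * x) ≤⟨ *-monoˡ-≤ _ (proj₁ (⁻¹-pos 0<z)) le ⟩
    z ⁻¹ * (z * y) ≈⟨ cancel y ⟩
    y            ∎
    where
    cancel : ∀ w → z ⁻¹ * (z * w) ≈ w
    cancel w = ℛ.trans (ℛ.sym (ℛ.*-assoc _ _ _))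
                 (ℛ.trans (ℛ.*-congʳ (*-inverseˡ 0<z)) (ℛ.*-identityˡ w))

  *-monoˡ-< : ∀ {x y} z → 0# < z → x < y → z * x < z * y
  *-monoˡ-< z 0<z (x≤y , x≉y) =
    *-monoˡ-≤ z (proj₁ 0<z) x≤y ,
    λ eq → x≉y (Ord.antisym x≤y (*-cancelˡ-≤ z 0<z (Ord.reflexive (ℛ.sym eq))))

  x<x+1 : ∀ x → x < x + 1#
  x<x+1 x = begin-strict
    x      ≈⟨ ℛ.+-identityˡ x ⟨
    0# + x <⟨ +-monoˡ-< x 0<1 ⟩
    1# + x ≈⟨ ℛ.+-comm 1# x ⟩
    x + 1# ∎

  ⁻¹-<1 : ∀ {x} → 1# < x → x ⁻¹ < 1#
  ⁻¹-<1 {x} 1<x = begin-strict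
    x ⁻¹      ≈⟨ ℛ.*-identityʳ _ ⟨
    x ⁻¹ * 1# <⟨ *-monoˡ-< (x ⁻¹) (⁻¹-pos 0<x) 1<x ⟩
    x ⁻¹ * x  ≈⟨ *-inverseˡ 0<x ⟩
    1#        ∎
    where
    0<x : 0# < x
    0<x = begin-strict 0# <⟨ 0<1 ⟩ 1# <⟨ 1<x ⟩ x ∎

  fromℕ-nonneg : ∀ n → 0# ≤ fromℕ n
  fromℕ-nonneg zero    = Ord.refl
  fromℕ-nonneg (suc n) = +-nonneg (0≤1 R) (fromℕ-nonneg n)

  fromℕ-pos : ∀ n .{{_ : NonZero n}} → 0# < fromℕ n
  fromℕ-pos (suc n) = begin-strict
    0#           <⟨ 0<1 ⟩
    1#           ≤⟨ x≤x+y (fromℕ-nonneg n) ⟩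
    fromℕ (suc n) ∎

  fromℕ-* : ∀ m n → fromℕ (m ℕ.* n) ≈ fromℕ m * fromℕ n
  fromℕ-* = SemiringMult.×1-homo-* semiring

  fromℕ-mono : ∀ {m n} → m ℕ.≤ n → fromℕ m ≤ fromℕ n
  fromℕ-mono {n = n} ℕ.z≤n = fromℕ-nonneg n
  fromℕ-mono (ℕ.s≤s m≤n)   = +-monoʳ-≤ 1# (fromℕ-mono m≤n)

  fromℕ-mono-< : ∀ {m n} → m ℕ.< n → fromℕ m < fromℕ n
  fromℕ-mono-< {m} {n} m<n = begin-strict
    fromℕ m       <⟨ x<x+1 _ ⟩
    fromℕ m + 1#  ≈⟨ ℛ.+-comm _ _ ⟩
    fromℕ (suc m) ≤⟨ fromℕ-mono m<n ⟩
    fromℕ n       ∎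

  n×x≈fromℕn*x : ∀ n x → MonoidMult._×_ ℛ.+-monoid n x ≈ fromℕ n * x
  n×x≈fromℕn*x n x = ℛ.sym (ℛ.trans (SemiringMult.×-assoc-* semiring n 1# x)
    (MonoidMult.×-congʳ ℛ.+-monoid n (ℛ.*-identityˡ x)))

  module _ (em : ExcludedMiddle 0ℓ) where

    -- If every natural number were at most `x`, the naturals would have a supremum `s`. With `n`
    -- also `suc n` lies below `s`, so `s - 1#` would be a smaller upper bound.
    archimedean : ∀ x → ∃[ n ] x < fromℕ n
    archimedean x with em {∃[ n ] ¬ (fromℕ n ≤ x)}
    ... | yes (n , n≰x) = n , NonStrictToStrict.≰⇒> _≈_ _≤_ ℛ.sym Ord.reflexive Ord.total n≰x
    ... | no  none      = begin-contradiction
      s           ≤⟨ least (s - 1#) (λ { r (n , r≈n) → +-cancelʳ-≤ 1# (begin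
        r + 1#        ≈⟨ ℛ.+-congʳ r≈n ⟩
        fromℕ n + 1#  ≈⟨ ℛ.+-comm _ _ ⟩
        fromℕ (suc n) ≤⟨ bound _ (suc n , ℛ.refl) ⟩
        s             ≈⟨ x-y+y≈x s 1# ⟨
        s - 1# + 1#   ∎) }) ⟩
      s - 1#      <⟨ x<x+1 (s - 1#) ⟩
      s - 1# + 1# ≈⟨ x-y+y≈x s 1# ⟩
      s           ∎
      where
      fromℕ≤x : ∀ n → fromℕ n ≤ x
      fromℕ≤x n = decidable-stable em λ n≰x → none (n , n≰x)
      lub = supremum (λ r → ∃[ n ] r ≈ fromℕ n) (0# , 0 , ℛ.refl)
              (x , λ { r (n , r≈n) → Ord.trans (Ord.reflexive r≈n) (fromℕ≤x n) })
      s     = proj₁ lub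
      bound = proj₁ (proj₂ lub)
      least = proj₂ (proj₂ lub)

-- Polynomials grow more slowly than the exponential.

module Growth (R : RealNumbers) where
  open RealNumbers R
  open OrderedField R
  open ≤-Reasoning
  open NaturalCoefficients ℛ.commutativeSemiring using (solve; _:=_; _:+_; _:*_; con)

  exp-nonneg : ∀ {x} → 0# ≤ x → 0# ≤ exp x
  exp-nonneg {x} 0≤x = begin
    0#     ≤⟨ +-nonneg (0≤1 R) 0≤x ⟩
    1# + x ≤⟨ 1+x≤exp x ⟩
    exp x  ∎

  -- If `y ≤ x`, multiplying `1# + (x - y) ≤ exp (x - y)` by `exp y` gives
  -- `exp y * (1# + (x - y)) ≤ exp x ≤ exp y`, which forces `x - y ≤ 0#`. The hypothesis `0# ≤ x`
  -- yields `1# ≤ exp x ≤ exp y`, so that `exp y` can be cancelled. This serves to bound a logarithm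
  -- from below, `log` being known only through `exp-log`.
  exp-cancel-≤ : ∀ {x y} → 0# ≤ x → exp x ≤ exp y → x ≤ y
  exp-cancel-≤ {x} {y} 0≤x le with Ord.total x y
  ... | inj₁ x≤y = x≤y
  ... | inj₂ y≤x = begin
    x         ≈⟨ x-y+y≈x x y ⟨
    x - y + y ≤⟨ +-monoˡ-≤ y (*-cancelˡ-≤ (exp y) 0<exp-y exp-y*[x-y]≤0) ⟩
    0# + y    ≈⟨ ℛ.+-identityˡ y ⟩
    y         ∎
    where
    0<exp-y : 0# < exp y
    0<exp-y = begin-strict
      0#     <⟨ 0<1 ⟩
      1#     ≤⟨ x≤x+y 0≤x ⟩
      1# + x ≤⟨ 1+x≤exp x ⟩
      exp x  ≤⟨ le ⟩
      exp y  ∎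
    exp-y*[x-y]≤0 : exp y * (x - y) ≤ exp y * 0#
    exp-y*[x-y]≤0 = +-cancelʳ-≤ (exp y) (begin
      exp y * (x - y) + exp y  ≈⟨ solve 2 (λ a b → a :* b :+ a := a :* (con 1 :+ b)) ℛ.refl (exp y) (x - y) ⟩
      exp y * (1# + (x - y))   ≤⟨ *-monoˡ-≤ (exp y) (proj₁ 0<exp-y) (1+x≤exp (x - y)) ⟩
      exp y * exp (x - y)      ≈⟨ ℛ.*-comm _ _ ⟩
      exp (x - y) * exp y      ≈⟨ exp-+ (x - y) y ⟨
      exp (x - y + y)          ≈⟨ exp-cong (x-y+y≈x x y) ⟩
      exp x                    ≤⟨ le ⟩
      exp y                    ≈⟨ ℛ.+-identityˡ _ ⟨
      0# + exp y               ≈⟨ ℛ.+-congʳ (ℛ.zeroʳ (exp y)) ⟨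
      exp y * 0# + exp y       ∎)

  -- A one-sided form of f = o(exp): there is no lower bound on `f`, so negative coefficients are
  -- harmless. Quantifying over all multiples `a` gives closure under sums, and `0# ≤ x₀` allows
  -- thresholds to be added.
  Subexponential : (ℝ → ℝ) → Set
  Subexponential f = ∀ a → 0# ≤ a → ∃[ x₀ ] 0# ≤ x₀ × (∀ x → x₀ ≤ x → a * f x ≤ exp x)

  2# : ℝ
  2# = 1# + 1#

  0<2 : 0# < 2#
  0<2 = begin-strict
    0# <⟨ 0<1 ⟩
    1# ≤⟨ x≤x+y (0≤1 R) ⟩
    2# ∎

  ^-nonneg : ∀ {x} n → 0# ≤ x → 0# ≤ x ^ n
  ^-nonneg zero    0≤x = 0≤1 R
  ^-nonneg (suc n) 0≤x = *-nonneg 0≤x (^-nonneg n 0≤x)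

  -- exp x = exp (x/2) * exp (x/2), where one factor is bounded below by x/2
  -- and the other one by induction.
  ^-subexponential : ∀ n → Subexponential (_^ n)
  ^-subexponential zero a 0≤a = a , 0≤a , λ x a≤x → begin
    a * 1# ≈⟨ ℛ.*-identityʳ a ⟩
    a      ≤⟨ a≤x ⟩
    x      ≤⟨ y≤x+y (0≤1 R) ⟩
    1# + x ≤⟨ 1+x≤exp x ⟩
    exp x  ∎
  ^-subexponential (suc n) a 0≤a = 2# * x₀ , *-nonneg (proj₁ 0<2) 0≤x₀ , bound
    where
    a′ = a * 2# ^ suc n
    ih = ^-subexponential n a′ (*-nonneg 0≤a (^-nonneg (suc n) (proj₁ 0<2)))
    x₀ = proj₁ ih
    0≤x₀ = proj₁ (proj₂ ih)
    bound : ∀ x → 2# * x₀ ≤ x → a * x ^ suc n ≤ exp x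
    bound x 2x₀≤x = begin
      a * x ^ suc n
        ≈⟨ ℛ.*-congˡ (^-congˡ (suc n) x≈2h) ⟩
      a * (2# * h) ^ suc n
        ≈⟨ ℛ.*-congˡ (CommutativeSemiringExp.^-distrib-* ℛ.commutativeSemiring 2# h (suc n)) ⟩
      a * (2# ^ suc n * (h * h ^ n))
        ≈⟨ solve 4 (λ a b c d → a :* (b :* (c :* d)) := a :* b :* d :* c) ℛ.refl a (2# ^ suc n) h (h ^ n) ⟩
      a′ * h ^ n * h
        ≤⟨ *-mono-≤ 0≤h (exp-nonneg 0≤h) (proj₂ (proj₂ ih) h x₀≤h) (Ord.trans (y≤x+y (0≤1 R)) (1+x≤exp h)) ⟩
      exp h * exp h
        ≈⟨ exp-+ h h ⟨
      exp (h + h)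
        ≈⟨ exp-cong (solve 1 (λ h → h :+ h := con 2 :* h) ℛ.refl h) ⟩
      exp (2# * h)
        ≈⟨ exp-cong x≈2h ⟨
      exp x ∎
      where
      open SemiringExp semiring using (^-congˡ)
      h = 2# ⁻¹ * x
      x≈2h : x ≈ 2# * h
      x≈2h = begin-equality
        x               ≈⟨ ℛ.*-identityˡ x ⟨
        1# * x          ≈⟨ ℛ.*-congʳ (*-inverse (0<⇒≉0 0<2)) ⟨
        2# * 2# ⁻¹ * x  ≈⟨ ℛ.*-assoc _ _ _ ⟩
        2# * h          ∎
      x₀≤h : x₀ ≤ h
      x₀≤h = *-cancelˡ-≤ 2# 0<2 (Ord.trans 2x₀≤x (Ord.reflexive x≈2h))
      0≤h : 0# ≤ h
      0≤h = Ord.trans 0≤x₀ x₀≤h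

  cx^n-subexponential : ∀ c n → Subexponential (λ x → c * x ^ n)
  cx^n-subexponential c n a 0≤a with Ord.total 0# c
  ... | inj₁ 0≤c with x₀ , 0≤x₀ , bound ← ^-subexponential n (a * c) (*-nonneg 0≤a 0≤c) =
    x₀ , 0≤x₀ , λ x x₀≤x → Ord.trans (Ord.reflexive (ℛ.sym (ℛ.*-assoc a c (x ^ n)))) (bound x x₀≤x)
  -- A monomial with a nonpositive coefficient is at most 0 on nonnegative arguments, so the
  -- threshold 0 suffices.
  ... | inj₂ c≤0 = 0# , Ord.refl , λ x 0≤x → begin
    a * (c * x ^ n)  ≤⟨ *-monoˡ-≤ a 0≤a (*-monoʳ-≤ (x ^ n) (^-nonneg n 0≤x) c≤0) ⟩
    a * (0# * x ^ n) ≈⟨ solve 2 (λ a b → a :* (con 0 :* b) := con 0) ℛ.refl a (x ^ n) ⟩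
    0#               ≤⟨ exp-nonneg 0≤x ⟩
    exp x            ∎

  +-subexponential : ∀ {f g} → Subexponential f → Subexponential g →
                     Subexponential (λ x → f x + g x)
  +-subexponential {f} {g} sf sg a 0≤a
    with x₁ , 0≤x₁ , bound₁ ← sf (2# * a) (*-nonneg (proj₁ 0<2) 0≤a)
       | x₂ , 0≤x₂ , bound₂ ← sg (2# * a) (*-nonneg (proj₁ 0<2) 0≤a) =
    -- The sum of the two nonnegative thresholds replaces their maximum. Each summand was bounded
    -- with the multiple `2# * a`, so the total is at most `2# * exp x`, and the factor 2 cancels.
    x₁ + x₂ , +-nonneg 0≤x₁ 0≤x₂ , λ x le → *-cancelˡ-≤ 2# 0<2 (begin
      2# * (a * (f x + g x))
        ≈⟨ solve 3 (λ a b c → con 2 :* (a :* (b :+ c)) := con 2 :* a :* b :+ con 2 :* a :* c)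
             ℛ.refl a (f x) (g x) ⟩
      2# * a * f x + 2# * a * g x
        ≤⟨ +-mono-≤ (bound₁ x (Ord.trans (x≤x+y 0≤x₂) le)) (bound₂ x (Ord.trans (y≤x+y 0≤x₁) le)) ⟩
      exp x + exp x
        ≈⟨ solve 1 (λ a → a :+ a := con 2 :* a) ℛ.refl (exp x) ⟩
      2# * exp x ∎)

  subexponential-resp : ∀ {f g} → (∀ x → f x ≈ g x) → Subexponential f → Subexponential g
  subexponential-resp f≈g sf a 0≤a with x₀ , 0≤x₀ , bound ← sf a 0≤a =
    x₀ , 0≤x₀ , λ x le → Ord.trans (Ord.reflexive (ℛ.*-congˡ (ℛ.sym (f≈g x)))) (bound x le)

  -- The growing variable sits in the slot of log (1/δ), while those of n, 1/ε and 1/β stay fixed;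
  -- in each monomial their powers are absorbed into the coefficient. Later this lets δ outweigh the
  -- sample bound.
  polynomial-subexponential : ∀ (q : Polynomial R 4) n u w →
    Subexponential (λ x → ⟦_⟧ R q (n ∷ u ∷ x ∷ w ∷ []))
  polynomial-subexponential [] n u w a 0≤a = 0# , Ord.refl , λ x 0≤x →
    Ord.trans (Ord.reflexive (ℛ.zeroʳ a)) (exp-nonneg 0≤x)
  polynomial-subexponential ((c , i ∷ j ∷ k ∷ l ∷ []) ∷ q) n u w = +-subexponential
    (subexponential-resp
      (λ x → solve 5 (λ c n u x w → c :* n :* u :* w :* x := c :* (n :* (u :* (x :* (w :* con 1)))))
               ℛ.refl c (n ^ i) (u ^ j) (x ^ k) (w ^ l))
      (cx^n-subexponential (c * n ^ i * u ^ j * w ^ l) k))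
    (polynomial-subexponential q n u w)

-- Finite sums, expectations, product distributions and push-forwards.

module Probability (R : RealNumbers) where
  open RealNumbers R
  open OrderedField R
  open ≤-Reasoning
  open NaturalCoefficients ℛ.commutativeSemiring using (solve; _:=_; _:*_)
  open CommutativeMonoidSum ℛ.+-commutativeMonoid using (∑-distrib-+; ∑-comm; sum-replicate)
  open SemiringSum semiring using (sum-cong-≋; *-distribˡ-sum)

  sum-mono : ∀ {n} {f g : Fin n → ℝ} → (∀ i → f i ≤ g i) → sum f ≤ sum g
  sum-mono {zero}  f≤g = Ord.refl
  sum-mono {suc n} f≤g = +-mono-≤ (f≤g zero) (sum-mono (f≤g ∘ suc))

  sum-nonneg : ∀ {n} {f : Fin n → ℝ} → (∀ i → 0# ≤ f i) → 0# ≤ sum f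
  sum-nonneg {zero}  0≤f = Ord.refl
  sum-nonneg {suc n} 0≤f = +-nonneg (0≤f zero) (sum-nonneg (0≤f ∘ suc))

  term≤sum : ∀ {n} {f : Fin n → ℝ} → (∀ i → 0# ≤ f i) → ∀ k → f k ≤ sum f
  term≤sum 0≤f zero    = x≤x+y (sum-nonneg (0≤f ∘ suc))
  term≤sum 0≤f (suc k) = Ord.trans (term≤sum (0≤f ∘ suc) k) (y≤x+y (0≤f zero))

  sum-const : ∀ n c → sum {n} (λ _ → c) ≈ fromℕ n * c
  sum-const n c = ℛ.trans (sum-replicate n) (n×x≈fromℕn*x n c)

  sum-zero : ∀ {n} {f : Fin n → ℝ} → (∀ i → f i ≈ 0#) → sum f ≈ 0#
  sum-zero {n} f≈0 = ℛ.trans (sum-cong-≋ f≈0) (ℛ.trans (sum-const n 0#) (ℛ.zeroʳ _))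

  sum-single : ∀ {n} {f : Fin n → ℝ} k → (∀ i → i ≢ k → f i ≈ 0#) → sum f ≈ f k
  sum-single zero    f≈0 =
    ℛ.trans (ℛ.+-congˡ (sum-zero λ i → f≈0 (suc i) λ ())) (ℛ.+-identityʳ _)
  sum-single (suc k) f≈0 =
    ℛ.trans (ℛ.+-cong (f≈0 zero λ ()) (sum-single k λ i i≢k → f≈0 (suc i) (i≢k ∘ Fin.suc-injective)))
            (ℛ.+-identityˡ _)

  𝟙-true : ∀ {P : Set} (P? : Dec P) → P → 𝟙 R (does P?) ≡ 1#
  𝟙-true P? p = ≡.cong (𝟙 R) (dec-true P? p)

  𝟙-false : ∀ {P : Set} (P? : Dec P) → ¬ P → 𝟙 R (does P?) ≡ 0#
  𝟙-false P? ¬p = ≡.cong (𝟙 R) (dec-false P? ¬p)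

  𝟙-nonneg : ∀ b → 0# ≤ 𝟙 R b
  𝟙-nonneg true  = 0≤1 R
  𝟙-nonneg false = Ord.refl

  𝟙≤1 : ∀ b → 𝟙 R b ≤ 1#
  𝟙≤1 true  = Ord.refl
  𝟙≤1 false = 0≤1 R

  𝟙-≤ : ∀ {P : Set} (P? : Dec P) {r} → 0# ≤ r → (P → 1# ≤ r) → 𝟙 R (does P?) ≤ r
  𝟙-≤ (yes p) 0≤r 1≤r = 1≤r p
  𝟙-≤ (no ¬p) 0≤r 1≤r = 0≤r

  Σᶠ-single : ∀ X {f : Carrier X → ℝ} x → (∀ z → z ≢ x → f z ≈ 0#) → Σᶠ R X f ≈ f x
  Σᶠ-single X {f} x f≈0 =
    ℛ.trans (sum-single (Inverse.to e x) λ i i≢x → f≈0 (Inverse.from e i) λ eq →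
              i≢x (≡.trans (≡.sym (Inverse.strictlyInverseˡ e i)) (≡.cong (Inverse.to e) eq)))
            (ℛ.reflexive (≡.cong f (Inverse.strictlyInverseʳ e x)))
    where e = FinSet.enumeration X

  module _ (X : FinSet) where

    Σᶠ-cong : ∀ {f g : Carrier X → ℝ} → (∀ x → f x ≈ g x) → Σᶠ R X f ≈ Σᶠ R X g
    Σᶠ-cong {f} {g} f≈g =
      sum-cong-≋ {∣ X ∣ᶠ} {f ∘ FinSet.element X} {g ∘ FinSet.element X} λ i → f≈g _

    Σᶠ-mono : ∀ {f g : Carrier X → ℝ} → (∀ x → f x ≤ g x) → Σᶠ R X f ≤ Σᶠ R X g
    Σᶠ-mono {f} {g} f≤g =
      sum-mono {∣ X ∣ᶠ} {f ∘ FinSet.element X} {g ∘ FinSet.element X} λ i → f≤g _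

    Σᶠ-nonneg : ∀ {f : Carrier X → ℝ} → (∀ x → 0# ≤ f x) → 0# ≤ Σᶠ R X f
    Σᶠ-nonneg {f} 0≤f = sum-nonneg {∣ X ∣ᶠ} {f ∘ FinSet.element X} λ i → 0≤f _

    Σᶠ-*ˡ : ∀ c (f : Carrier X → ℝ) → Σᶠ R X (λ x → c * f x) ≈ c * Σᶠ R X f
    Σᶠ-*ˡ c f = ℛ.sym (*-distribˡ-sum c (f ∘ FinSet.element X))

    Σᶠ-+ : ∀ (f g : Carrier X → ℝ) → Σᶠ R X (λ x → f x + g x) ≈ Σᶠ R X f + Σᶠ R X g
    Σᶠ-+ f g = ∑-distrib-+ (f ∘ FinSet.element X) (g ∘ FinSet.element X)

    Σᶠ-sum : ∀ {n} (f : Fin n → Carrier X → ℝ) →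
             Σᶠ R X (λ x → sum (λ i → f i x)) ≈ sum (λ i → Σᶠ R X (f i))
    Σᶠ-sum f = ∑-comm (λ j i → f i (FinSet.element X j))

  module _ {X : FinSet} (D : Distribution R X) where

    𝔼-cong : ∀ {f g : Carrier X → ℝ} → (∀ x → f x ≈ g x) → 𝔼 R D f ≈ 𝔼 R D g
    𝔼-cong f≈g = Σᶠ-cong X λ x → ℛ.*-congˡ {prob D x} (f≈g x)

    𝔼-mono : ∀ {f g : Carrier X → ℝ} → (∀ x → f x ≤ g x) → 𝔼 R D f ≤ 𝔼 R D g
    𝔼-mono f≤g = Σᶠ-mono X λ x → *-monoˡ-≤ (prob D x) (Distribution.nonneg D x) (f≤g x)

    𝔼-nonneg : ∀ {f : Carrier X → ℝ} → (∀ x → 0# ≤ f x) → 0# ≤ 𝔼 R D f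
    𝔼-nonneg 0≤f = Σᶠ-nonneg X λ x → *-nonneg (Distribution.nonneg D x) (0≤f x)

    𝔼-*ˡ : ∀ c (f : Carrier X → ℝ) → 𝔼 R D (λ x → c * f x) ≈ c * 𝔼 R D f
    𝔼-*ˡ c f = ℛ.trans
      (Σᶠ-cong X λ x → x∙yz≈y∙xz (prob D x) c (f x))
      (Σᶠ-*ˡ X c (λ x → prob D x * f x))
      where
      x∙yz≈y∙xz : ∀ x y z → x * (y * z) ≈ y * (x * z)
      x∙yz≈y∙xz = solve 3 (λ x y z → x :* (y :* z) := y :* (x :* z)) ℛ.refl

    𝔼-+ : ∀ (f g : Carrier X → ℝ) → 𝔼 R D (λ x → f x + g x) ≈ 𝔼 R D f + 𝔼 R D g
    𝔼-+ f g = ℛ.trans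
      (Σᶠ-cong X λ x → ℛ.distribˡ (prob D x) (f x) (g x))
      (Σᶠ-+ X (λ x → prob D x * f x) (λ x → prob D x * g x))

    𝔼-const : ∀ c → 𝔼 R D (λ _ → c) ≈ c
    𝔼-const c = begin-equality
      𝔼 R D (λ _ → c)               ≈⟨ Σᶠ-cong X (λ x → ℛ.*-comm (prob D x) c) ⟩
      Σᶠ R X (λ x → c * prob D x)   ≈⟨ Σᶠ-*ˡ X c (prob D) ⟩
      c * Σᶠ R X (prob D)           ≈⟨ ℛ.*-congˡ (Distribution.total≈1 D) ⟩
      c * 1#                        ≈⟨ ℛ.*-identityʳ c ⟩
      c                             ∎

    𝔼-≤ : ∀ {f : Carrier X → ℝ} {c} → (∀ x → f x ≤ c) → 𝔼 R D f ≤ c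
    𝔼-≤ f≤c = Ord.trans (𝔼-mono f≤c) (Ord.reflexive (𝔼-const _))

    ≤-𝔼 : ∀ {f : Carrier X → ℝ} {c} → (∀ x → c ≤ f x) → c ≤ 𝔼 R D f
    ≤-𝔼 c≤f = Ord.trans (Ord.reflexive (ℛ.sym (𝔼-const _))) (𝔼-mono c≤f)

    𝔼-sum : ∀ {n} (f : Fin n → Carrier X → ℝ) →
            𝔼 R D (λ x → sum (λ i → f i x)) ≈ sum (λ i → 𝔼 R D (f i))
    𝔼-sum f = ℛ.trans
      (Σᶠ-cong X λ x → *-distribˡ-sum (prob D x) (λ i → f i x))
      (Σᶠ-sum X (λ i x → prob D x * f i x))

    𝔼-Σᶠ : ∀ Y (f : Carrier X → Carrier Y → ℝ) →
           𝔼 R D (λ x → Σᶠ R Y (f x)) ≈ Σᶠ R Y (λ y → 𝔼 R D (λ x → f x y))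
    𝔼-Σᶠ Y f = 𝔼-sum (λ j x → f x (FinSet.element Y j))

    𝔼-≟ : ∀ x → 𝔼 R D (λ z → 𝟙 R (does (FinSet._≟_ X z x))) ≈ prob D x
    𝔼-≟ x = ℛ.trans
      (Σᶠ-single X x λ z z≢x →
        ℛ.trans (ℛ.*-congˡ (ℛ.reflexive (𝟙-false (FinSet._≟_ X z x) z≢x))) (ℛ.zeroʳ (prob D z)))
      (ℛ.trans (ℛ.*-congˡ (ℛ.reflexive (𝟙-true (FinSet._≟_ X x x) ≡.refl))) (ℛ.*-identityʳ (prob D x)))

    𝔼-swap : ∀ {Y} (E : Distribution R Y) (f : Carrier X → Carrier Y → ℝ) →
             𝔼 R D (λ x → 𝔼 R E (f x)) ≈ 𝔼 R E (λ y → 𝔼 R D (λ x → f x y))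
    𝔼-swap {Y} E f = ℛ.trans
      (𝔼-Σᶠ Y λ x y → prob E y * f x y)
      (Σᶠ-cong Y λ y → 𝔼-*ˡ (prob E y) (λ x → f x y))

  𝔼-congᴰ : ∀ {X} {D E : Distribution R X} (f : Carrier X → ℝ) → (∀ x → prob D x ≈ prob E x) →
            𝔼 R D f ≈ 𝔼 R E f
  𝔼-congᴰ {X} f D≐E = Σᶠ-cong X λ x → ℛ.*-congʳ {f x} (D≐E x)

  𝔼-∷ : ∀ {X} (D : Distribution R X) n (f : Vec (Carrier X) (suc n) → ℝ) →
        𝔼 R (iid R D (suc n)) f ≈ 𝔼 R D (λ x → 𝔼 R (iid R D n) (λ xs → f (x ∷ xs)))
  𝔼-∷ {X} D n f = ℛ.trans (Σᶠ-∷ R X n (λ xs → prob (iid R D (suc n)) xs * f xs))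
    (Σᶠ-cong X λ x → ℛ.trans
      (Σᶠ-cong (X ^ᶠ n) λ xs → ℛ.*-assoc (prob D x) (prob (iid R D n) xs) (f (x ∷ xs)))
      (Σᶠ-*ˡ (X ^ᶠ n) (prob D x) (λ xs → prob (iid R D n) xs * f (x ∷ xs))))

  -- Induction on the position; at the head, Fubini moves the draw of that entry inside, and
  -- averaging over the overwritten entry changes nothing. Every later independence argument has
  -- this form: after resampling, the new entry is independent of all of `S`.
  resample : ∀ {X} (D : Distribution R X) {n} (i : Fin n) (f : Vec (Carrier X) n → ℝ) →
    𝔼 R (iid R D n) f ≈ 𝔼 R (iid R D n) (λ S → 𝔼 R D (λ x → f (S [ i ]≔ x)))
  resample {X} D {suc n} zero f = begin-equality
    𝔼 R (iid R D (suc n)) f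
      ≈⟨ 𝔼-∷ D n f ⟩
    𝔼 R D (λ x → 𝔼 R (iid R D n) (λ xs → f (x ∷ xs)))
      ≈⟨ 𝔼-swap D (iid R D n) (λ x xs → f (x ∷ xs)) ⟩
    𝔼 R (iid R D n) (λ xs → 𝔼 R D (λ x → f (x ∷ xs)))
      ≈⟨ 𝔼-const D _ ⟨
    𝔼 R D (λ _ → 𝔼 R (iid R D n) (λ xs → 𝔼 R D (λ x → f (x ∷ xs))))
      ≈⟨ 𝔼-∷ D n (λ S → 𝔼 R D (λ x → f (S [ zero ]≔ x))) ⟨
    𝔼 R (iid R D (suc n)) (λ S → 𝔼 R D (λ x → f (S [ zero ]≔ x))) ∎
  resample {X} D {suc n} (suc i) f = begin-equality
    𝔼 R (iid R D (suc n)) f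
      ≈⟨ 𝔼-∷ D n f ⟩
    𝔼 R D (λ x → 𝔼 R (iid R D n) (λ xs → f (x ∷ xs)))
      ≈⟨ 𝔼-cong D (λ x → resample D i (λ xs → f (x ∷ xs))) ⟩
    𝔼 R D (λ x → 𝔼 R (iid R D n) (λ xs → 𝔼 R D (λ z → f (x ∷ (xs [ i ]≔ z)))))
      ≈⟨ 𝔼-∷ D n (λ S → 𝔼 R D (λ x → f (S [ suc i ]≔ x))) ⟨
    𝔼 R (iid R D (suc n)) (λ S → 𝔼 R D (λ x → f (S [ suc i ]≔ x))) ∎

  𝔼-take : ∀ {X} (D : Distribution R X) n {r} (f : Vec (Carrier X) n → ℝ) →
    𝔼 R (iid R D (n ℕ.+ r)) (λ S → f (Vec.take n S)) ≈ 𝔼 R (iid R D n) f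
  𝔼-take {X} D zero {r} f = begin-equality
    𝔼 R (iid R D r) (λ _ → f []) ≈⟨ 𝔼-const (iid R D r) (f []) ⟩
    f []                         ≈⟨ 𝔼-const (iid R D 0) (f []) ⟨
    𝔼 R (iid R D 0) f            ∎
  𝔼-take D (suc n) {r} f = begin-equality
    𝔼 R (iid R D (suc n ℕ.+ r)) (λ S → f (Vec.take (suc n) S))
      ≈⟨ 𝔼-∷ D (n ℕ.+ r) (λ S → f (Vec.take (suc n) S)) ⟩
    𝔼 R D (λ x → 𝔼 R (iid R D (n ℕ.+ r)) (λ S → f (x ∷ Vec.take n S)))
      ≈⟨ 𝔼-cong D (λ x → 𝔼-take D n (λ S → f (x ∷ S))) ⟩
    𝔼 R D (λ x → 𝔼 R (iid R D n) (λ S → f (x ∷ S)))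
      ≈⟨ 𝔼-∷ D n f ⟨
    𝔼 R (iid R D (suc n)) f ∎

  dirac : ∀ {X} → Carrier X → Distribution R X
  dirac {X} x = record
    { prob    = λ z → 𝟙 R (does (FinSet._≟_ X z x))
    ; nonneg  = λ z → 𝟙-nonneg (does (FinSet._≟_ X z x))
    ; total≈1 = ℛ.trans
        (Σᶠ-single X x λ z z≢x → ℛ.reflexive (𝟙-false (FinSet._≟_ X z x) z≢x))
        (ℛ.reflexive (𝟙-true (FinSet._≟_ X x x) ≡.refl))
    }

  𝔼-dirac : ∀ {X} x (f : Carrier X → ℝ) → 𝔼 R (dirac {X} x) f ≈ f x
  𝔼-dirac {X} x f = ℛ.trans
    (Σᶠ-single X x λ z z≢x →
      ℛ.trans (ℛ.*-congʳ (ℛ.reflexive (𝟙-false (FinSet._≟_ X z x) z≢x))) (ℛ.zeroˡ _))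
    (ℛ.trans (ℛ.*-congʳ (ℛ.reflexive (𝟙-true (FinSet._≟_ X x x) ≡.refl))) (ℛ.*-identityˡ _))

  bind : ∀ {X Y} → Distribution R X → (Carrier X → Distribution R Y) → Distribution R Y
  bind {X} {Y} D k = record
    { prob    = λ y → 𝔼 R D (λ x → prob (k x) y)
    ; nonneg  = λ y → 𝔼-nonneg D λ x → Distribution.nonneg (k x) y
    ; total≈1 = begin-equality
        Σᶠ R Y (λ y → 𝔼 R D (λ x → prob (k x) y))
          ≈⟨ 𝔼-Σᶠ D Y (λ x → prob (k x)) ⟨
        𝔼 R D (λ x → Σᶠ R Y (prob (k x)))
          ≈⟨ 𝔼-cong D (λ x → Distribution.total≈1 (k x)) ⟩
        𝔼 R D (λ _ → 1#)
          ≈⟨ 𝔼-const D 1# ⟩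
        1# ∎
    }

  𝔼-bind : ∀ {X Y} (D : Distribution R X) (k : Carrier X → Distribution R Y) (f : Carrier Y → ℝ) →
           𝔼 R (bind D k) f ≈ 𝔼 R D (λ x → 𝔼 R (k x) f)
  𝔼-bind {X} {Y} D k f = begin-equality
    Σᶠ R Y (λ y → 𝔼 R D (λ x → prob (k x) y) * f y)
      ≈⟨ Σᶠ-cong Y (λ y → ℛ.*-comm (𝔼 R D (λ x → prob (k x) y)) (f y)) ⟩
    Σᶠ R Y (λ y → f y * 𝔼 R D (λ x → prob (k x) y))
      ≈⟨ Σᶠ-cong Y (λ y → 𝔼-*ˡ D (f y) (λ x → prob (k x) y)) ⟨
    Σᶠ R Y (λ y → 𝔼 R D (λ x → f y * prob (k x) y))
      ≈⟨ 𝔼-Σᶠ D Y (λ x y → f y * prob (k x) y) ⟨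
    𝔼 R D (λ x → Σᶠ R Y (λ y → f y * prob (k x) y))
      ≈⟨ 𝔼-cong D (λ x → Σᶠ-cong Y λ y → ℛ.*-comm (f y) (prob (k x) y)) ⟩
    𝔼 R D (λ x → 𝔼 R (k x) f) ∎

  map : ∀ {X Y} → (Carrier X → Carrier Y) → Distribution R X → Distribution R Y
  map {Y = Y} g D = bind D (λ x → dirac {Y} (g x))

  𝔼-map : ∀ {X Y} (g : Carrier X → Carrier Y) (D : Distribution R X) (f : Carrier Y → ℝ) →
          𝔼 R (map {Y = Y} g D) f ≈ 𝔼 R D (f ∘ g)
  𝔼-map {X} {Y} g D f = ℛ.trans (𝔼-bind D (λ x → dirac {Y} (g x)) f)
                                 (𝔼-cong D λ x → 𝔼-dirac {Y} (g x) f)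

  -- This allows samples from the uniform distribution on a graph to be treated as uniform indices
  -- to which the function is then applied, and back.
  𝔼-iid-map : ∀ {X Y} (g : Carrier X → Carrier Y) (D : Distribution R X) n
              (f : Vec (Carrier Y) n → ℝ) →
              𝔼 R (iid R (map {Y = Y} g D) n) f ≈ 𝔼 R (iid R D n) (f ∘ Vec.map g)
  𝔼-iid-map {X} {Y} g D zero    f = ℛ.refl
  𝔼-iid-map {X} {Y} g D (suc n) f = begin-equality
    𝔼 R (iid R (map {Y = Y} g D) (suc n)) f
      ≈⟨ 𝔼-∷ (map {Y = Y} g D) n f ⟩
    𝔼 R (map {Y = Y} g D) (λ y → 𝔼 R (iid R (map {Y = Y} g D) n) (λ ys → f (y ∷ ys)))
      ≈⟨ 𝔼-cong (map {Y = Y} g D) (λ y → 𝔼-iid-map {Y = Y} g D n (λ ys → f (y ∷ ys))) ⟩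
    𝔼 R (map {Y = Y} g D) (λ y → 𝔼 R (iid R D n) (λ xs → f (y ∷ Vec.map g xs)))
      ≈⟨ 𝔼-map {Y = Y} g D (λ y → 𝔼 R (iid R D n) (λ xs → f (y ∷ Vec.map g xs))) ⟩
    𝔼 R D (λ x → 𝔼 R (iid R D n) (λ xs → f (g x ∷ Vec.map g xs)))
      ≈⟨ 𝔼-∷ D n (f ∘ Vec.map g) ⟨
    𝔼 R (iid R D (suc n)) (f ∘ Vec.map g) ∎

  finᶠ : ℕ → FinSet
  finᶠ n = finSet (Fin n) (↔-id (Fin n))

  uniform : ∀ n .{{_ : NonZero n}} → Distribution R (finᶠ n)
  uniform n = record
    { prob    = λ _ → fromℕ n ⁻¹
    ; nonneg  = λ _ → proj₁ (⁻¹-pos (fromℕ-pos n))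
    ; total≈1 = ℛ.trans (sum-const n _) (*-inverse (0<⇒≉0 (fromℕ-pos n)))
    }

-- Algorithms reading a single entry are not blatantly non-private.

module Leakage (R : RealNumbers) where
  open RealNumbers R
  open OrderedField R
  open Probability R
  open ≤-Reasoning
  open NaturalCoefficients ℛ.commutativeSemiring using (solve; _:=_; _:*_)
  open CommutativeMonoidSum ℛ.+-commutativeMonoid using (∑-distrib-+)

  DependsOnlyOn : ∀ {X n Y} → Fin n → Algorithm R X n Y → Set
  DependsOnlyOn i M = ∀ S S′ → lookup S i ≡ lookup S′ i → ∀ y → prob (run M S) y ≈ prob (run M S′) y

  module _ {X : FinSet} (D : Distribution R X) {κ : ℝ} (0≤κ : 0# ≤ κ) (D≤κ : ∀ x → prob D x ≤ κ) where
    open DecMembership (FinSet._≟_ X) using (_∈?_)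

    -- Union bound: a member of `S` equals one of its `n` entries, and each of these has mass at
    -- most `κ`.
    Pr-∈-≤ : ∀ {n} (S : Vec (Carrier X) n) →
             𝔼 R D (λ x → 𝟙 R (does (x ∈? S))) ≤ fromℕ n * κ
    Pr-∈-≤ {n} S = begin
      𝔼 R D (λ x → 𝟙 R (does (x ∈? S)))
        ≤⟨ 𝔼-mono D (λ x → 𝟙-≤ (x ∈? S) (sum-nonneg (0≤ x)) λ x∈S → begin
             1#                       ≡⟨ 𝟙-true (_ ≟ _) (lookup-index x∈S) ⟨
             x ≟¹ lookup S (index x∈S) ≤⟨ term≤sum (0≤ x) (index x∈S) ⟩
             sum (λ j → x ≟¹ lookup S j) ∎) ⟩
      𝔼 R D (λ x → sum (λ j → x ≟¹ lookup S j))
        ≈⟨ 𝔼-sum D (λ j x → x ≟¹ lookup S j) ⟩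
      sum (λ j → 𝔼 R D (λ x → x ≟¹ lookup S j))
        ≤⟨ sum-mono (λ j → Ord.trans (Ord.reflexive (𝔼-≟ D (lookup S j))) (D≤κ (lookup S j))) ⟩
      sum {n} (λ _ → κ)
        ≈⟨ sum-const n κ ⟩
      fromℕ n * κ ∎
      where
      open FinSet X using (_≟_)
      _≟¹_ : Carrier X → Carrier X → ℝ
      x ≟¹ z = 𝟙 R (does (x ≟ z))
      0≤ : ∀ x j → 0# ≤ x ≟¹ lookup S j
      0≤ x j = 𝟙-nonneg (does (x ≟ lookup S j))

    module _ {n Y} (M : Algorithm R X n Y) (A : Carrier Y → Distribution R (X ^ᶠ n)) where

      hit : Fin n → Vec (Carrier X) n → ℝ
      hit j S = 𝔼 R (run M S) (λ y → 𝔼 R (A y) (λ S′ → 𝟙 R (does (lookup S j ∈? S′))))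

      𝔼-recovered : 𝔼 R (iid R D n) (λ S → 𝔼 R (run M S) (λ y → 𝔼 R (A y) (recovered R X S)))
                    ≈ sum (λ j → 𝔼 R (iid R D n) (hit j))
      𝔼-recovered = begin-equality
        𝔼 R (iid R D n) (λ S → 𝔼 R (run M S) (λ y → 𝔼 R (A y) (recovered R X S)))
          ≈⟨ 𝔼-cong (iid R D n) (λ S → ℛ.trans
               (𝔼-cong (run M S) λ y → 𝔼-sum (A y) (λ j S′ → 𝟙 R (does (lookup S j ∈? S′))))
               (𝔼-sum (run M S) (λ j y → 𝔼 R (A y) (λ S′ → 𝟙 R (does (lookup S j ∈? S′)))))) ⟩
        𝔼 R (iid R D n) (λ S → sum (λ j → hit j S))
          ≈⟨ 𝔼-sum (iid R D n) hit ⟩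
        sum (λ j → 𝔼 R (iid R D n) (hit j)) ∎

      hit≤1 : ∀ j → 𝔼 R (iid R D n) (hit j) ≤ 1#
      hit≤1 j = 𝔼-≤ (iid R D n) λ S → 𝔼-≤ (run M S) λ y → 𝔼-≤ (A y) λ S′ →
        𝟙≤1 (does (lookup S j ∈? S′))

      -- Entry `j` is not read, so it can be redrawn without affecting the output. By Fubini the
      -- adversary's guess `S′` may then be fixed before the new entry is drawn, and `Pr-∈-≤`
      -- applies.
      hit≤nκ : ∀ {i} → DependsOnlyOn i M → ∀ j → j ≢ i → 𝔼 R (iid R D n) (hit j) ≤ fromℕ n * κ
      hit≤nκ {i} dep j j≢i = begin
        𝔼 R (iid R D n) (hit j)
          ≈⟨ resample D j (hit j) ⟩
        𝔼 R (iid R D n) (λ S → 𝔼 R D (λ x → hit j (S [ j ]≔ x)))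
          ≈⟨ 𝔼-cong (iid R D n) (λ S → 𝔼-cong D λ x → unread S x) ⟩
        𝔼 R (iid R D n) (λ S → 𝔼 R D (λ x →
          𝔼 R (run M S) (λ y → 𝔼 R (A y) (λ S′ → 𝟙 R (does (x ∈? S′))))))
          ≈⟨ 𝔼-cong (iid R D n) (λ S → ℛ.trans
               (𝔼-swap D (run M S) (λ x y → 𝔼 R (A y) (λ S′ → 𝟙 R (does (x ∈? S′)))))
               (𝔼-cong (run M S) λ y → 𝔼-swap D (A y) (λ x S′ → 𝟙 R (does (x ∈? S′))))) ⟩
        𝔼 R (iid R D n) (λ S → 𝔼 R (run M S) (λ y →
          𝔼 R (A y) (λ S′ → 𝔼 R D (λ x → 𝟙 R (does (x ∈? S′))))))
          ≤⟨ 𝔼-≤ (iid R D n) (λ S → 𝔼-≤ (run M S) λ y → 𝔼-≤ (A y) Pr-∈-≤) ⟩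
        fromℕ n * κ ∎
        where
        unread : ∀ S x → hit j (S [ j ]≔ x)
                         ≈ 𝔼 R (run M S) (λ y → 𝔼 R (A y) (λ S′ → 𝟙 R (does (x ∈? S′))))
        unread S x = begin-equality
          𝔼 R (run M (S [ j ]≔ x)) (λ y → 𝔼 R (A y) (λ S′ → 𝟙 R (does (lookup (S [ j ]≔ x) j ∈? S′))))
            ≡⟨ ≡.cong (λ z → 𝔼 R (run M (S [ j ]≔ x)) (λ y → 𝔼 R (A y) (λ S′ → 𝟙 R (does (z ∈? S′)))))
                 (lookup∘update j S x) ⟩
          𝔼 R (run M (S [ j ]≔ x)) (λ y → 𝔼 R (A y) (λ S′ → 𝟙 R (does (x ∈? S′))))
            ≈⟨ 𝔼-congᴰ {D = run M (S [ j ]≔ x)} {E = run M S} (λ y → 𝔼 R (A y) (λ S′ → 𝟙 R (does (x ∈? S′))))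
                 (dep (S [ j ]≔ x) S (lookup∘update′ (j≢i ∘ ≡.sym) S x)) ⟩
          𝔼 R (run M S) (λ y → 𝔼 R (A y) (λ S′ → 𝟙 R (does (x ∈? S′)))) ∎

      𝔼-recovered≤ : ∀ {i} → DependsOnlyOn i M →
        𝔼 R (iid R D n) (λ S → 𝔼 R (run M S) (λ y → 𝔼 R (A y) (recovered R X S)))
          ≤ 1# + fromℕ n * (fromℕ n * κ)
      𝔼-recovered≤ {i} dep = begin
        𝔼 R (iid R D n) (λ S → 𝔼 R (run M S) (λ y → 𝔼 R (A y) (recovered R X S)))
          ≈⟨ 𝔼-recovered ⟩
        sum (λ j → 𝔼 R (iid R D n) (hit j))
          ≤⟨ sum-mono bound ⟩
        -- The indicator charges 1 to the entry that is read; the term for unread entries is granted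
        -- to all `n` of them, which costs little and keeps the sum uniform.
        sum (λ j → 𝟙 R (does (j Fin.≟ i)) + fromℕ n * κ)
          ≈⟨ ∑-distrib-+ (λ j → 𝟙 R (does (j Fin.≟ i))) (λ _ → fromℕ n * κ) ⟩
        sum (λ j → 𝟙 R (does (j Fin.≟ i))) + sum {n} (λ _ → fromℕ n * κ)
          ≈⟨ ℛ.+-cong (ℛ.trans (sum-single i λ j j≢i → ℛ.reflexive (𝟙-false (j Fin.≟ i) j≢i))
                               (ℛ.reflexive (𝟙-true (i Fin.≟ i) ≡.refl)))
                      (sum-const n (fromℕ n * κ)) ⟩
        1# + fromℕ n * (fromℕ n * κ) ∎
        where
        bound : ∀ j → 𝔼 R (iid R D n) (hit j) ≤ 𝟙 R (does (j Fin.≟ i)) + fromℕ n * κ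
        bound j with j Fin.≟ i
        ... | yes _  = Ord.trans (hit≤1 j) (x≤x+y (*-nonneg (fromℕ-nonneg n) 0≤κ))
        ... | no j≢i = Ord.trans (hit≤nκ dep j j≢i) (y≤x+y Ord.refl)

  -- For κ = 1/(100n²), at most 1 + 1/100 entries are recovered on average, whereas 0.9n is at least
  -- 1.8 for n ≥ 2. Multiplying by 10 clears the fraction; the gap is wide enough to bound 10n²κ by
  -- 100n²κ = 1, leaving 18 against 11.
  DependsOnlyOn⇒¬BlatantlyNonPrivate : ∀ {X n Y} .{{_ : NonZero n}} (M : Algorithm R X n Y) i →
    1 ℕ.< n → DependsOnlyOn i M → ¬ BlatantlyNonPrivate R M
  DependsOnlyOn⇒¬BlatantlyNonPrivate {X} {n} M i 1<n dep (D , D≤κ , A , recovers) =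
    begin-contradiction
      fromℕ 18
        ≤⟨ fromℕ-mono (ℕ.*-monoʳ-≤ 9 1<n) ⟩
      fromℕ (9 ℕ.* n)
        ≈⟨ fromℕ-* 9 n ⟩
      fromℕ 9 * fromℕ n
        ≈⟨ ℛ.*-identityˡ _ ⟨
      1# * (fromℕ 9 * fromℕ n)
        ≈⟨ ℛ.*-congʳ (*-inverse (0<⇒≉0 (fromℕ-pos 10))) ⟨
      fromℕ 10 * fromℕ 10 ⁻¹ * (fromℕ 9 * fromℕ n)
        ≈⟨ rearrange (fromℕ 10) (fromℕ 10 ⁻¹) (fromℕ 9) (fromℕ n) ⟩
      fromℕ 10 * (fromℕ 9 * fromℕ 10 ⁻¹ * fromℕ n)
        ≤⟨ *-monoˡ-≤ (fromℕ 10) (fromℕ-nonneg 10) (Ord.trans recovers (𝔼-recovered≤ D 0≤κ D≤κ M A dep)) ⟩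
      fromℕ 10 * (1# + fromℕ n * (fromℕ n * κ))
        ≈⟨ ℛ.distribˡ (fromℕ 10) 1# _ ⟩
      fromℕ 10 * 1# + fromℕ 10 * (fromℕ n * (fromℕ n * κ))
        ≤⟨ +-mono-≤ (Ord.reflexive (ℛ.*-identityʳ (fromℕ 10))) 10n²κ≤1 ⟩
      fromℕ 10 + 1#
        ≈⟨ ℛ.+-comm _ _ ⟩
      fromℕ 11
        <⟨ fromℕ-mono-< (ℕ.m≤m+n 12 6) ⟩
      fromℕ 18 ∎
    where
    instance
      100n²≢0 : NonZero (100 ℕ.* n ℕ.^ 2)
      100n²≢0 = ℕ.m*n≢0 100 (n ℕ.^ 2) {{_}} {{ℕ.m^n≢0 n 2}}
    κ = fromℕ (100 ℕ.* n ℕ.^ 2) ⁻¹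
    0≤κ : 0# ≤ κ
    0≤κ = proj₁ (⁻¹-pos (fromℕ-pos (100 ℕ.* n ℕ.^ 2)))
    rearrange : ∀ d t e n → d * t * (e * n) ≈ d * (e * t * n)
    rearrange = solve 4 (λ d t e n → d :* t :* (e :* n) := d :* (e :* t :* n)) ℛ.refl
    10n²κ≤1 : fromℕ 10 * (fromℕ n * (fromℕ n * κ)) ≤ 1#
    10n²κ≤1 = begin
      fromℕ 10 * (fromℕ n * (fromℕ n * κ))
        ≤⟨ *-monoʳ-≤ _ (*-nonneg (fromℕ-nonneg n) (*-nonneg (fromℕ-nonneg n) 0≤κ)) (fromℕ-mono (ℕ.m≤m+n 10 90)) ⟩
      fromℕ 100 * (fromℕ n * (fromℕ n * κ))
        ≈⟨ solve 3 (λ d n k → d :* (n :* (n :* k)) := d :* (n :* n) :* k) ℛ.refl (fromℕ 100) (fromℕ n) κ ⟩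
      fromℕ 100 * (fromℕ n * fromℕ n) * κ
        ≈⟨ ℛ.*-congʳ (ℛ.*-congˡ (fromℕ-* n n)) ⟨
      fromℕ 100 * fromℕ (n ℕ.* n) * κ
        ≈⟨ ℛ.*-congʳ (fromℕ-* 100 (n ℕ.* n)) ⟨
      fromℕ (100 ℕ.* (n ℕ.* n)) * κ
        ≡⟨ ≡.cong (λ m → fromℕ (100 ℕ.* (n ℕ.* m)) * κ) (ℕ.*-identityʳ n) ⟨
      fromℕ (100 ℕ.* n ℕ.^ 2) * κ
        ≈⟨ *-inverse (0<⇒≉0 (fromℕ-pos (100 ℕ.* n ℕ.^ 2))) ⟩
      1# ∎

-- The candidate privacy measures and their axioms.

module Measures (R : RealNumbers) where
  open RealNumbers R
  open OrderedField R
  open Growth R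
  open Probability R
  open Leakage R
  open ≤-Reasoning

  firstSamples : ∀ {X n Y} r → Algorithm R X n Y → Algorithm R X (n ℕ.+ r) Y
  firstSamples {n = n} r M = algorithm λ S → run M (Vec.take n S)

  Solves-firstSamples : ∀ {X n Y} r (M : Algorithm R X n Y) (t : StatisticalTask R X Y) {β β′} →
    β ≤ β′ → Solves R M t β → Solves R (firstSamples r M) t β′
  Solves-firstSamples {n = n} r M t {β} {β′} β≤β′ solves D d = begin
    1# - β′
      ≤⟨ +-cancelʳ-≤ β′ (begin
           1# - β′ + β′ ≈⟨ x-y+y≈x 1# β′ ⟩
           1#           ≈⟨ x-y+y≈x 1# β ⟨
           1# - β + β   ≤⟨ +-monoʳ-≤ (1# - β) β≤β′ ⟩
           1# - β + β′  ∎) ⟩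
    1# - β
      ≤⟨ solves D d ⟩
    𝔼 R (iid R D n) (λ S → Pr R (run M S) (StatisticalTask.𝒯 t D d))
      ≈⟨ 𝔼-take D n (λ S → Pr R (run M S) (StatisticalTask.𝒯 t D d)) ⟨
    𝔼 R (iid R D (n ℕ.+ r)) (λ S → Pr R (run (firstSamples r M) S) (StatisticalTask.𝒯 t D d)) ∎

  DependsOnlyOn-firstSamples : ∀ {X n Y} r {M : Algorithm R X n Y} {i} →
    DependsOnlyOn i M → DependsOnlyOn (i ↑ˡ r) (firstSamples r M)
  DependsOnlyOn-firstSamples {X} {n} r {M} {i} dep S S′ eq =
    dep (Vec.take n S) (Vec.take n S′) (≡.trans (≡.sym (lookup-take S)) (≡.trans eq (lookup-take S′)))
    where
    lookup-take : ∀ S → lookup S (i ↑ˡ r) ≡ lookup (Vec.take n S) i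
    lookup-take S = ≡.trans (≡.cong (λ T → lookup T (i ↑ˡ r)) (≡.sym (take++drop≡id n S)))
                            (lookup-++ˡ (Vec.take n S) (Vec.drop n S) i)

  module _ (P : PrivacyMeasure R) where
    open PrivacyMeasure P

    linearScalability : (∀ {X n Y} r (M : Algorithm R X n Y) → Private M → μ (firstSamples r M) ≤ 0#) →
                        LinearScalability R P
    -- The empty polynomial evaluates to 0, so the scaling must work for every positive `k`; both
    -- constants are 1.
    linearScalability free = [] , 1# , 0<1 , 1# , 0<1 , scale
      where
      scale : ∀ {X n Y} (M : Algorithm R X n Y) → Private M → ∀ β → 0# < β →
        ∀ k .{{_ : NonZero k}} → ⟦_⟧ R [] (fromℕ n ∷ β ⁻¹ ∷ []) ≤ fromℕ k →
        ∃[ M′ ] Equivalent R {m = k ℕ.* n} β (1# * β) M′ M × μ M′ ≤ 1# * fromℕ k ⁻¹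
      -- Matching `k` as `suc k′` unfolds `k ℕ.* n` to `n ℕ.+ k′ ℕ.* n`, the sample size of
      -- `firstSamples (k′ ℕ.* n) M`.
      scale {n = n} M private-M β _ k@(suc k′) _ =
        firstSamples (k′ ℕ.* n) M ,
        (λ t → Solves-firstSamples (k′ ℕ.* n) M t (Ord.reflexive (ℛ.sym (ℛ.*-identityˡ β)))) ,
        Ord.trans (free (k′ ℕ.* n) M private-M)
          (*-nonneg (0≤1 R) (proj₁ (⁻¹-pos (fromℕ-pos k))))

    -- Both the exponent `c` and the power of the logarithm are chosen as 0, so neither `ℓ` nor `n`
    -- enters the bound and only `K * ε ≤ 1#` is left to exploit.
    strongComposition : ∀ K → 0# < K →
      (∀ {X n Y ℓ} .{{_ : NonZero ℓ}} (M : Fin ℓ → Algorithm R X n Y) ε →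
        (∀ i → μ (M i) ≤ ε) → K * ε ≤ 1# → Private (compose R M)) →
      StrongComposition R P
    strongComposition K 0<K composes = 0# , 0<1 , K , 0<K , 0 , composes′
      where
      composes′ : ∀ {X n Y ℓ} .{{_ : NonZero ℓ}} (M : Fin ℓ → Algorithm R X n Y) (ε : ℝ) →
        (∀ i → μ (M i) ≤ ε) →
        K * (ε * fromℕ ℓ ^ʳ 0# * log (fromℕ (n ℕ.+ 2)) ^ 0) ≤ 1# →
        Private (compose R M)
      composes′ {ℓ = ℓ@(suc _)} M ε μ≤ε small = composes M ε μ≤ε (begin
        K * ε
          ≤⟨ *-monoˡ-≤ K (proj₁ 0<K) (begin
               ε                           ≈⟨ ℛ.*-identityʳ ε ⟨
               ε * 1#                      ≤⟨ *-monoˡ-≤ ε 0≤ε 1≤ℓ⁰ ⟩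
               ε * fromℕ ℓ ^ʳ 0#           ≈⟨ ℛ.*-identityʳ _ ⟨
               ε * fromℕ ℓ ^ʳ 0# * 1#      ∎) ⟩
        K * (ε * fromℕ ℓ ^ʳ 0# * 1#)
          ≤⟨ small ⟩
        1# ∎)
        where
        0≤ε : 0# ≤ ε
        -- `ε` bounds the nonnegative measure of `M zero`, which exists since `ℓ` is nonzero.
        0≤ε = Ord.trans (nonneg (M zero)) (μ≤ε zero)
        1≤ℓ⁰ : 1# ≤ fromℕ ℓ ^ʳ 0#
        1≤ℓ⁰ = begin
          1#                          ≈⟨ ℛ.+-identityʳ 1# ⟨
          1# + 0#                     ≈⟨ ℛ.+-congˡ (ℛ.zeroˡ _) ⟨
          1# + 0# * log (fromℕ ℓ)     ≤⟨ 1+x≤exp _ ⟩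
          exp (0# * log (fromℕ ℓ))    ∎

  zeroMeasure : PrivacyMeasure R
  zeroMeasure = record { μ = λ _ → 0# ; nonneg = λ _ → Ord.refl ; cong = λ _ _ _ → ℛ.refl }

  zeroMeasure-axioms : ∀ j → j ≢ 1F → Axiom R zeroMeasure j
  zeroMeasure-axioms 0F _   = (λ _ _ → Ord.refl) , (λ _ _ → Ord.refl)
  zeroMeasure-axioms 1F j≢1 = contradiction ≡.refl j≢1
  zeroMeasure-axioms 2F _   =
    strongComposition zeroMeasure 1# 0<1 λ _ _ _ _ → 0≤1 R
  zeroMeasure-axioms 3F _   =
    linearScalability zeroMeasure λ _ _ _ → Ord.refl

  -- A common form for the three measures other than zero: `A` selects the positions that may be
  -- read, and `a` is the measure of the algorithms reading only such a position. As `a ≤ 1#`,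
  -- exactly these are private.
  module EntryMeasure (em : ExcludedMiddle 0ℓ) (A : ∀ {n} → Fin n → Set)
                      (a : ℝ) (0≤a : 0# ≤ a) (a≤1 : a ≤ 1#) where

    -- With a single sample every algorithm depends on one entry only and may reveal it entirely;
    -- `1 ℕ.< n` rules this out.
    ReadsOneEntry : ∀ {X n Y} → Algorithm R X n Y → Set
    ReadsOneEntry {n = n} M = 1 ℕ.< n × ∃[ i ] A i × DependsOnlyOn i M

    μ₀ : ∀ {X n Y} → Algorithm R X n Y → ℝ
    μ₀ M = if does (em {ReadsOneEntry M}) then a else 2#

    a≤2 : a ≤ 2#
    a≤2 = Ord.trans a≤1 (x≤x+y (0≤1 R))

    μ₀-reads : ∀ {X n Y} (M : Algorithm R X n Y) → ReadsOneEntry M → μ₀ M ≈ a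
    μ₀-reads M reads with em {ReadsOneEntry M}
    ... | yes _      = ℛ.refl
    ... | no ¬reads = contradiction reads ¬reads

    μ₀≤1⇒reads : ∀ {X n Y} (M : Algorithm R X n Y) → μ₀ M ≤ 1# → ReadsOneEntry M
    μ₀≤1⇒reads M μ≤1 with em {ReadsOneEntry M}
    ... | yes reads = reads
    ... | no _       = begin-contradiction
      2# ≤⟨ μ≤1 ⟩
      1# <⟨ x<x+1 1# ⟩
      2# ∎

    a≤μ₀ : ∀ {X n Y} (M : Algorithm R X n Y) → a ≤ μ₀ M
    a≤μ₀ M with em {ReadsOneEntry M}
    ... | yes _ = Ord.refl
    ... | no  _ = a≤2

    -- There are only two values, and `a` is the smaller one, so an implication decides the
    -- comparison. Invariance under `cong` and both halves of preprocessing reduce to this.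
    μ₀-anti : ∀ {X n Y X′ n′ Y′} (M : Algorithm R X n Y) (M′ : Algorithm R X′ n′ Y′) →
              (ReadsOneEntry M → ReadsOneEntry M′) → μ₀ M′ ≤ μ₀ M
    μ₀-anti M M′ f with em {ReadsOneEntry M} | em {ReadsOneEntry M′}
    ... | yes s | yes _ = Ord.refl
    ... | yes s | no ¬s′ = contradiction (f s) ¬s′
    ... | no _  | yes _ = a≤2
    ... | no _  | no _ = Ord.refl

    measure : PrivacyMeasure R
    measure = record
      { μ      = μ₀
      ; nonneg = λ M → Ord.trans 0≤a (a≤μ₀ M)
      ; cong   = λ M M′ M≈M′ → Ord.antisym
          (μ₀-anti M′ M λ { (1<n , i , Ai , dep) → 1<n , i , Ai , λ S S′ eq y →
            ℛ.trans (M≈M′ S y) (ℛ.trans (dep S S′ eq y) (ℛ.sym (M≈M′ S′ y))) })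
          (μ₀-anti M M′ λ { (1<n , i , Ai , dep) → 1<n , i , Ai , λ S S′ eq y →
            ℛ.trans (ℛ.sym (M≈M′ S y)) (ℛ.trans (dep S S′ eq y) (M≈M′ S′ y)) })
      }

    -- A permutation moves the entry read from `i` to `π ⟨$⟩ʳ i`, so admissibility must not depend
    -- on the position. A map `σ` acts entrywise and leaves the position alone.
    preprocessingᴱ : (∀ {m n} (i : Fin m) (j : Fin n) → A i → A j) →
      Preprocessing R measure
    preprocessingᴱ all =
      (λ M π → μ₀-anti M (permuteInput R π M) λ { (1<n , i , Ai , dep) →
        1<n , π ⟨$⟩ʳ i , all i (π ⟨$⟩ʳ i) Ai , λ S S′ eq → dep _ _
          (≡.trans (lookup∘tabulate (λ j → lookup S (π ⟨$⟩ʳ j)) i)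
            (≡.trans eq (≡.sym (lookup∘tabulate (λ j → lookup S′ (π ⟨$⟩ʳ j)) i)))) }) ,
      (λ M σ → μ₀-anti M (mapInput R σ M) λ { (1<n , i , Ai , dep) →
        1<n , i , Ai , λ S S′ eq → dep _ _
          (≡.trans (lookup-map i σ S) (≡.trans (≡.cong σ eq) (≡.sym (lookup-map i σ S′)))) })

    noBlatantNonPrivacyᴱ : NoBlatantNonPrivacy R measure
    noBlatantNonPrivacyᴱ M private-M with 1<n , i , _ , dep ← μ₀≤1⇒reads M private-M =
      DependsOnlyOn⇒¬BlatantlyNonPrivate M i 1<n dep

    -- With K = 1 the premise makes every component private. Uniqueness of the admissible position
    -- forces all components to read the same entry, and then so does their product distribution.
    strongCompositionᴱ : (∀ {n} (i j : Fin n) → A i → A j → i ≡ j) →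
      StrongComposition R measure
    strongCompositionᴱ unique = strongComposition measure 1# 0<1 composes
      where
      open CommutativeMonoidSum *-commutativeMonoid using () renaming (sum-cong-≋ to product-cong-≋)
      composes : ∀ {X n Y ℓ} .{{_ : NonZero ℓ}} (M : Fin ℓ → Algorithm R X n Y) ε →
        (∀ i → μ₀ (M i) ≤ ε) → 1# * ε ≤ 1# → μ₀ (compose R M) ≤ 1#
      composes {ℓ = suc ℓ} M ε μ≤ε ε≤1 =
        Ord.trans (Ord.reflexive (μ₀-reads (compose R M) (1<n , i , Ai , dep))) a≤1
        where
        reads : ∀ j → ReadsOneEntry (M j)
        reads j = μ₀≤1⇒reads (M j) (Ord.trans (μ≤ε j) (Ord.trans (Ord.reflexive (ℛ.sym (ℛ.*-identityˡ ε))) ε≤1))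
        1<n = proj₁ (reads zero)
        i = proj₁ (proj₂ (reads zero))
        Ai = proj₁ (proj₂ (proj₂ (reads zero)))
        dep : DependsOnlyOn i (compose R M)
        dep S S′ eq ys = product-cong-≋ {suc ℓ}
          {λ j → prob (run (M j) S) (lookup ys j)} {λ j → prob (run (M j) S′) (lookup ys j)} λ j →
          let _ , iⱼ , Aiⱼ , depⱼ = reads j in
          depⱼ S S′ (≡.subst (λ k → lookup S k ≡ lookup S′ k) (unique i iⱼ Ai Aiⱼ) eq) (lookup ys j)

    -- With K = 2 the composition axiom only concerns algorithms of measure at
    -- most 1/2, and there are none.
    strongComposition-vacuousᴱ : a ≈ 1# → StrongComposition R measure
    strongComposition-vacuousᴱ a≈1 = strongComposition measure 2# 0<2 vacuous
      where
      vacuous : ∀ {X n Y ℓ} .{{_ : NonZero ℓ}} (M : Fin ℓ → Algorithm R X n Y) ε →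
        (∀ i → μ₀ (M i) ≤ ε) → 2# * ε ≤ 1# → μ₀ (compose R M) ≤ 1#
      vacuous {ℓ = suc ℓ} M ε μ≤ε 2ε≤1 = begin-contradiction
        1#        <⟨ x<x+1 1# ⟩
        2#        ≈⟨ ℛ.*-identityʳ 2# ⟨
        2# * 1#   ≈⟨ ℛ.*-congˡ a≈1 ⟨
        2# * a    ≤⟨ *-monoˡ-≤ 2# (proj₁ 0<2) (Ord.trans (a≤μ₀ (M zero)) (μ≤ε zero)) ⟩
        2# * ε    ≤⟨ 2ε≤1 ⟩
        1#        ∎

    -- Additional samples are ignored and the entry read keeps its position as `i ↑ˡ r`. The measure
    -- therefore stays at `a`, and the value 0 is below every bound of order 1/k.
    linearScalabilityᴱ : a ≈ 0# → (∀ {n} r (i : Fin n) → A i → A (i ↑ˡ r)) →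
      LinearScalability R measure
    linearScalabilityᴱ a≈0 closed = linearScalability measure λ r M private-M →
      let 1<n , i , Ai , dep = μ₀≤1⇒reads M private-M in
      Ord.reflexive (ℛ.trans
        (μ₀-reads (firstSamples r M)
          (ℕ.m≤n⇒m≤n+o r 1<n , i ↑ˡ r , closed r i Ai , DependsOnlyOn-firstSamples r {M} dep))
        a≈0)

-- Differentially private algorithms fail on the support task.

module LowerBound (R : RealNumbers) where
  open RealNumbers R
  open OrderedField R
  open Growth R
  open Probability R
  open ≤-Reasoning
  open NaturalCoefficients ℛ.commutativeSemiring using (solve; _:=_; _:+_; _:*_; con)

  module _ {X : FinSet} {m} (M : Algorithm R X m X) {ε δ} (0≤ε : 0# ≤ ε)
           (dp : DifferentiallyPrivate R ε δ M)
           (D : Distribution R X) {κ} (D≤κ : ∀ x → prob D x ≤ κ) where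
    open FinSet X using (_≟_)

    -- Redraw entry `i` as `x`, then use privacy to run the algorithm on the old `S` instead, at the
    -- cost of a factor `exp ε` and a term `δ`. Now the output is independent of `x`, so for each
    -- fixed output the match has probability at most `κ`.
    Pr-outputs-entry : ∀ i →
      𝔼 R (iid R D m) (λ S → Pr R (run M S) (λ y → does (lookup S i ≟ y))) ≤ exp ε * κ + δ
    Pr-outputs-entry i = begin
      𝔼 R (iid R D m) (λ S → Pr R (run M S) (λ y → does (lookup S i ≟ y)))
        ≈⟨ resample D i (λ S → Pr R (run M S) (λ y → does (lookup S i ≟ y))) ⟩
      𝔼 R (iid R D m) (λ S → 𝔼 R D (λ x → Pr R (run M (S [ i ]≔ x)) (λ y → does (lookup (S [ i ]≔ x) i ≟ y))))
        ≤⟨ 𝔼-mono (iid R D m) (λ S → 𝔼-mono D λ x → forget S x) ⟩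
      𝔼 R (iid R D m) (λ S → 𝔼 R D (λ x → exp ε * Pr R (run M S) (λ y → does (x ≟ y)) + δ))
        ≤⟨ 𝔼-≤ (iid R D m) average ⟩
      exp ε * κ + δ ∎
      where
      forget : ∀ S x → Pr R (run M (S [ i ]≔ x)) (λ y → does (lookup (S [ i ]≔ x) i ≟ y))
                       ≤ exp ε * Pr R (run M S) (λ y → does (x ≟ y)) + δ
      forget S x = begin
        Pr R (run M (S [ i ]≔ x)) (λ y → does (lookup (S [ i ]≔ x) i ≟ y))
          ≡⟨ ≡.cong (λ z → Pr R (run M (S [ i ]≔ x)) (λ y → does (z ≟ y))) (lookup∘update i S x) ⟩
        Pr R (run M (S [ i ]≔ x)) (λ y → does (x ≟ y))
          ≤⟨ dp (S [ i ]≔ x) S (i , λ j j≢i → lookup∘update′ j≢i S x) (λ y → does (x ≟ y)) ⟩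
        exp ε * Pr R (run M S) (λ y → does (x ≟ y)) + δ ∎
      average : ∀ S → 𝔼 R D (λ x → exp ε * Pr R (run M S) (λ y → does (x ≟ y)) + δ) ≤ exp ε * κ + δ
      average S = begin
        𝔼 R D (λ x → exp ε * Pr R (run M S) (λ y → does (x ≟ y)) + δ)
          ≈⟨ 𝔼-+ D (λ x → exp ε * Pr R (run M S) (λ y → does (x ≟ y))) (λ _ → δ) ⟩
        𝔼 R D (λ x → exp ε * Pr R (run M S) (λ y → does (x ≟ y))) + 𝔼 R D (λ _ → δ)
          ≈⟨ ℛ.+-cong (𝔼-*ˡ D (exp ε) (λ x → Pr R (run M S) (λ y → does (x ≟ y)))) (𝔼-const D δ) ⟩
        exp ε * 𝔼 R D (λ x → Pr R (run M S) (λ y → does (x ≟ y))) + δ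
          ≈⟨ ℛ.+-congʳ (ℛ.*-congˡ (ℛ.trans
               (𝔼-swap D (run M S) (λ x y → 𝟙 R (does (x ≟ y))))
               (𝔼-cong (run M S) (𝔼-≟ D)))) ⟩
        exp ε * 𝔼 R (run M S) (prob D) + δ
          ≤⟨ +-monoˡ-≤ δ (*-monoˡ-≤ (exp ε) (exp-nonneg 0≤ε) (𝔼-≤ (run M S) D≤κ)) ⟩
        exp ε * κ + δ ∎

  -- The sample size is 2 because `ReadsOneEntry` demands more than one entry.
  firstEntry : ∀ X → Algorithm R X 2 X
  firstEntry X = algorithm λ S → dirac {X} (lookup S zero)

  module _ (em : ExcludedMiddle 0ℓ) where

    inSupport? : ∀ {X} (D : Distribution R X) y → Dec (¬ (prob D y ≈ 0#))
    inSupport? D y = em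

    supportTask : ∀ X → StatisticalTask R X X
    supportTask X = record
      { 𝒟      = λ _ → ⊤
      ; 𝒟-resp = λ _ d → d
      ; 𝒯      = λ D _ y → does (inSupport? D y)
      ; 𝒯-cong = λ {D} {D′} D≐D′ _ _ y → does-⇔
          (mk⇔ (λ D≉0 D′≈0 → D≉0 (ℛ.trans (D≐D′ y) D′≈0))
               (λ D′≉0 D≈0 → D′≉0 (ℛ.trans (ℛ.sym (D≐D′ y)) D≈0)))
          (inSupport? D y) (inSupport? D′ y)
      }

    -- Points outside the support carry weight 0, so a sample lies in the support with probability
    -- 1, and every nonnegative failure probability is met.
    firstEntry-solves : ∀ X {β} → 0# ≤ β → Solves R (firstEntry X) (supportTask X) β
    firstEntry-solves X {β} 0≤β D _ = begin
      1# - β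
        ≤⟨ x≤x+y 0≤β ⟩
      1# - β + β
        ≈⟨ x-y+y≈x 1# β ⟩
      1#
        ≈⟨ Distribution.total≈1 D ⟨
      Σᶠ R X (prob D)
        ≈⟨ Σᶠ-cong X weight ⟨
      𝔼 R D (𝟙 R ∘ T)
        ≈⟨ 𝔼-cong D (λ x → 𝔼-const (iid R D 1) (𝟙 R (T x))) ⟨
      𝔼 R D (λ x → 𝔼 R (iid R D 1) (λ _ → 𝟙 R (T x)))
        ≈⟨ 𝔼-∷ D 1 (λ S → 𝟙 R (T (lookup S zero))) ⟨
      𝔼 R (iid R D 2) (λ S → 𝟙 R (T (lookup S zero)))
        ≈⟨ 𝔼-cong (iid R D 2) (λ S → 𝔼-dirac {X} (lookup S zero) (𝟙 R ∘ T)) ⟨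
      𝔼 R (iid R D 2) (λ S → Pr R (run (firstEntry X) S) T) ∎
      where
      T : Subset X
      T y = does (inSupport? D y)
      weight : ∀ x → prob D x * 𝟙 R (T x) ≈ prob D x
      weight x with inSupport? D x
      ... | yes _ = ℛ.*-identityʳ _
      ... | no ¬D≉0 with em {prob D x ≈ 0#}
      ...   | yes D≈0 = ℛ.trans (ℛ.zeroʳ _) (ℛ.sym D≈0)
      ...   | no  D≉0 = contradiction D≉0 ¬D≉0

    module Grid (N : ℕ) .{{_ : NonZero N}} where

      grid : FinSet
      grid = finSet (Fin N × Fin N) (↔-sym Fin.*↔×)

      open FinSet grid using (_≟_)
      open DecMembership (Fin._≟_ {N}) using (_∈?_; _∉_)

      κ : ℝ
      κ = fromℕ N ⁻¹

      0≤κ : 0# ≤ κ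
      0≤κ = proj₁ (⁻¹-pos (fromℕ-pos N))

      U : Distribution R (finᶠ N)
      U = uniform N

      -- A function from [N] to [N] is stored as the vector `b` of its values. A uniformly random
      -- function is then `iid R U N`, and `resample` redraws a single value of it.
      point : Vec (Fin N) N → Fin N → Fin N × Fin N
      point b j = j , lookup b j

      uniformOnGraph : Vec (Fin N) N → Distribution R grid
      uniformOnGraph b = map {Y = grid} (point b) U

      -- Only the index `proj₁ y` can produce the point `y`, and each index has mass `κ`.
      uniformOnGraph≤κ : ∀ b y → prob (uniformOnGraph b) y ≤ κ
      uniformOnGraph≤κ b y = begin
        𝔼 R U (λ j → 𝟙 R (does (y ≟ point b j)))
          ≤⟨ 𝔼-mono U (λ j → 𝟙-≤ (y ≟ point b j) (𝟙-nonneg (does (j =ᶠ proj₁ y))) λ y≡ →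
               Ord.reflexive (ℛ.reflexive (≡.sym (𝟙-true (j =ᶠ proj₁ y) (≡.cong proj₁ (≡.sym y≡)))))) ⟩
        𝔼 R U (λ j → 𝟙 R (does (j =ᶠ proj₁ y)))
          ≈⟨ 𝔼-≟ U (proj₁ y) ⟩
        κ ∎
        where open FinSet (finᶠ N) using () renaming (_≟_ to _=ᶠ_)

      support⇒onGraph : ∀ b y → ¬ (prob (uniformOnGraph b) y ≈ 0#) → lookup b (proj₁ y) ≡ proj₂ y
      support⇒onGraph b y D≉0 with lookup b (proj₁ y) Fin.≟ proj₂ y
      ... | yes onGraph = onGraph
      ... | no  offGraph = contradiction (ℛ.trans
        (𝔼-cong U λ j → ℛ.reflexive (𝟙-false (y ≟ point b j) λ { ≡.refl → offGraph ≡.refl }))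
        (𝔼-const U 0#)) D≉0

      unseen : Vec (Fin N) N → ∀ {m} → Vec (Fin N) m → Fin N × Fin N → ℝ
      unseen b J (j , c) = if does (j ∈? J) then 0# else 𝟙 R (does (FinSet._≟_ (finᶠ N) (lookup b j) c))

      unseen-nonneg : ∀ b {m} (J : Vec (Fin N) m) y → 0# ≤ unseen b J y
      unseen-nonneg b J (j , c) with does (j ∈? J)
      ... | true  = Ord.refl
      ... | false = 𝟙-nonneg (does (FinSet._≟_ (finᶠ N) (lookup b j) c))

      -- A point of the support lies on the graph. If its index was sampled, it equals that sample,
      -- because `b` assigns only one label to an index; otherwise `unseen` counts it.
      support≤unseen+seen : ∀ b {m} (J : Vec (Fin N) m) y →
        𝟙 R (does (inSupport? (uniformOnGraph b) y)) ≤
          unseen b J y + sum (λ i → 𝟙 R (does (lookup (Vec.map (point b) J) i ≟ y)))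
      support≤unseen+seen b {m} J y@(j , c) =
        𝟙-≤ (inSupport? (uniformOnGraph b) y) (+-nonneg (unseen-nonneg b J y) (sum-nonneg seen-nonneg)) 1≤
        where
        S = Vec.map (point b) J
        seen-nonneg : ∀ i → 0# ≤ 𝟙 R (does (lookup S i ≟ y))
        seen-nonneg i = 𝟙-nonneg (does (lookup S i ≟ y))
        1≤ : ¬ (prob (uniformOnGraph b) y ≈ 0#) →
             1# ≤ unseen b J y + sum (λ i → 𝟙 R (does (lookup S i ≟ y)))
        1≤ D≉0 with support⇒onGraph b y D≉0 | j ∈? J
        ... | bj≡c | no _ = begin
          1# ≡⟨ 𝟙-true (FinSet._≟_ (finᶠ N) (lookup b j) c) bj≡c ⟨
          𝟙 R (does (FinSet._≟_ (finᶠ N) (lookup b j) c)) ≤⟨ x≤x+y (sum-nonneg seen-nonneg) ⟩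
          𝟙 R (does (FinSet._≟_ (finᶠ N) (lookup b j) c)) + sum (λ i → 𝟙 R (does (lookup S i ≟ y))) ∎
        ... | bj≡c | yes j∈J = begin
          1# ≡⟨ 𝟙-true (lookup S (index j∈J) ≟ y) Sᵢ≡y ⟨
          𝟙 R (does (lookup S (index j∈J) ≟ y)) ≤⟨ term≤sum seen-nonneg (index j∈J) ⟩
          sum (λ i → 𝟙 R (does (lookup S i ≟ y))) ≈⟨ ℛ.+-identityˡ _ ⟨
          0# + sum (λ i → 𝟙 R (does (lookup S i ≟ y))) ∎
          where
          Sᵢ≡y : lookup S (index j∈J) ≡ y
          Sᵢ≡y = ≡.trans (lookup-map (index j∈J) (point b) J)
                   (≡.trans (≡.cong (point b) (≡.sym (lookup-index j∈J))) (≡.cong (j ,_) bj≡c))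

      map-point-update : ∀ b {m} (J : Vec (Fin N) m) j c → j ∉ J →
        Vec.map (point (b [ j ]≔ c)) J ≡ Vec.map (point b) J
      map-point-update b []      j c j∉J = ≡.refl
      map-point-update b (k ∷ J) j c j∉J = ≡.cong₂ _∷_
        (≡.cong (k ,_) (lookup∘update′ (λ k≡j → j∉J (here (≡.sym k≡j))) b c))
        (map-point-update b J j c (j∉J ∘ there))

      module _ {m} (M : Algorithm R grid m grid) where

        outcome : Vec (Fin N) N → Vec (Fin N) m → Distribution R grid
        outcome b J = run M (Vec.map (point b) J)

        -- The sample J carries no information on the label of an index j outside
        -- J, so any guess of it is correct with probability 1/N.
        guess-unseen : ∀ J y → 𝔼 R (iid R U N) (λ b → prob (outcome b J) y * unseen b J y)
                               ≤ κ * 𝔼 R (iid R U N) (λ b → prob (outcome b J) y)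
        guess-unseen J y@(j , c) with j ∈? J
        ... | yes _ = begin
          𝔼 R (iid R U N) (λ b → prob (outcome b J) y * 0#)
            ≤⟨ 𝔼-≤ (iid R U N) (λ b → Ord.reflexive (ℛ.zeroʳ (prob (outcome b J) y))) ⟩
          0#
            ≤⟨ *-nonneg 0≤κ (𝔼-nonneg (iid R U N) λ b → Distribution.nonneg (outcome b J) y) ⟩
          κ * 𝔼 R (iid R U N) (λ b → prob (outcome b J) y) ∎
        ... | no j∉J = begin
          𝔼 R (iid R U N) (λ b → prob (outcome b J) y * (lookup b j ≟¹ c))
            ≈⟨ resample U j (λ b → prob (outcome b J) y * (lookup b j ≟¹ c)) ⟩
          𝔼 R (iid R U N) (λ b → 𝔼 R U (λ d →
            prob (outcome (b [ j ]≔ d) J) y * (lookup (b [ j ]≔ d) j ≟¹ c)))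
            ≈⟨ 𝔼-cong (iid R U N) (λ b → 𝔼-cong U λ d → ℛ.reflexive (≡.cong₂
                 (λ S e → prob (run M S) y * (e ≟¹ c)) (map-point-update b J j d j∉J) (lookup∘update j b d))) ⟩
          𝔼 R (iid R U N) (λ b → 𝔼 R U (λ d → prob (outcome b J) y * (d ≟¹ c)))
            ≈⟨ 𝔼-cong (iid R U N) (λ b → ℛ.trans
                 (𝔼-*ˡ U (prob (outcome b J) y) (λ d → d ≟¹ c))
                 (ℛ.trans (ℛ.*-congˡ (𝔼-≟ U c)) (ℛ.*-comm (prob (outcome b J) y) κ))) ⟩
          𝔼 R (iid R U N) (λ b → κ * prob (outcome b J) y)
            ≈⟨ 𝔼-*ˡ (iid R U N) κ (λ b → prob (outcome b J) y) ⟩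
          κ * 𝔼 R (iid R U N) (λ b → prob (outcome b J) y) ∎
          where
          _≟¹_ : Fin N → Fin N → ℝ
          d ≟¹ e = 𝟙 R (does (FinSet._≟_ (finᶠ N) d e))

        -- The indices `J` and the output `y` are fixed first and `b` is averaged, which gives a
        -- factor `κ` for each `y` separately. Summing over `y` loses nothing, since the output
        -- probabilities add up to 1.
        𝔼-unseen≤κ : 𝔼 R (iid R U N) (λ b → 𝔼 R (iid R U m) (λ J → 𝔼 R (outcome b J) (unseen b J))) ≤ κ
        𝔼-unseen≤κ = begin
          𝔼 R (iid R U N) (λ b → 𝔼 R (iid R U m) (λ J → 𝔼 R (outcome b J) (unseen b J)))
            ≈⟨ 𝔼-swap (iid R U N) (iid R U m) (λ b J → 𝔼 R (outcome b J) (unseen b J)) ⟩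
          𝔼 R (iid R U m) (λ J → 𝔼 R (iid R U N) (λ b → 𝔼 R (outcome b J) (unseen b J)))
            ≤⟨ 𝔼-≤ (iid R U m) bound ⟩
          κ ∎
          where
          bound : ∀ J → 𝔼 R (iid R U N) (λ b → 𝔼 R (outcome b J) (unseen b J)) ≤ κ
          bound J = begin
            𝔼 R (iid R U N) (λ b → 𝔼 R (outcome b J) (unseen b J))
              ≈⟨ 𝔼-Σᶠ (iid R U N) grid (λ b y → prob (outcome b J) y * unseen b J y) ⟩
            Σᶠ R grid (λ y → 𝔼 R (iid R U N) (λ b → prob (outcome b J) y * unseen b J y))
              ≤⟨ Σᶠ-mono grid (guess-unseen J) ⟩
            Σᶠ R grid (λ y → κ * 𝔼 R (iid R U N) (λ b → prob (outcome b J) y))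
              ≈⟨ Σᶠ-*ˡ grid κ (λ y → 𝔼 R (iid R U N) (λ b → prob (outcome b J) y)) ⟩
            κ * Σᶠ R grid (λ y → 𝔼 R (iid R U N) (λ b → prob (outcome b J) y))
              ≈⟨ ℛ.*-congˡ (𝔼-Σᶠ (iid R U N) grid (λ b y → prob (outcome b J) y)) ⟨
            κ * 𝔼 R (iid R U N) (λ b → Σᶠ R grid (prob (outcome b J)))
              ≈⟨ ℛ.*-congˡ (ℛ.trans (𝔼-cong (iid R U N) (λ b → Distribution.total≈1 (outcome b J)))
                                    (𝔼-const (iid R U N) 1#)) ⟩
            κ * 1#
              ≈⟨ ℛ.*-identityʳ κ ⟩
            κ ∎

        module _ {ε δ} (0≤ε : 0# ≤ ε) (dp : DifferentiallyPrivate R ε δ M) where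

          -- The bound of `Pr-outputs-entry`, summed over the `m` samples.
          leak : ℝ
          leak = fromℕ m * (exp ε * κ + δ)

          success≤ : ∀ b →
            𝔼 R (iid R (uniformOnGraph b) m)
                (λ S → Pr R (run M S) (λ y → does (inSupport? (uniformOnGraph b) y)))
              ≤ 𝔼 R (iid R U m) (λ J → 𝔼 R (outcome b J) (unseen b J)) + leak
          success≤ b = begin
            𝔼 R (iid R D m) (λ S → Pr R (run M S) T)
              ≈⟨ 𝔼-iid-map {Y = grid} (point b) U m (λ S → Pr R (run M S) T) ⟩
            𝔼 R (iid R U m) (λ J → Pr R (outcome b J) T)
              ≤⟨ 𝔼-mono (iid R U m) (λ J → 𝔼-mono (outcome b J) (support≤unseen+seen b J)) ⟩
            𝔼 R (iid R U m) (λ J → 𝔼 R (outcome b J) (λ y →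
              unseen b J y + sum (λ i → seen i (Vec.map (point b) J) y)))
              ≈⟨ 𝔼-cong (iid R U m) (λ J → ℛ.trans
                   (𝔼-+ (outcome b J) (unseen b J) (λ y → sum (λ i → seen i (Vec.map (point b) J) y)))
                   (ℛ.+-congˡ (𝔼-sum (outcome b J) (λ i → seen i (Vec.map (point b) J))))) ⟩
            𝔼 R (iid R U m) (λ J → 𝔼 R (outcome b J) (unseen b J) +
                                   sum (λ i → 𝔼 R (outcome b J) (seen i (Vec.map (point b) J))))
              ≈⟨ 𝔼-+ (iid R U m) (λ J → 𝔼 R (outcome b J) (unseen b J))
                                 (λ J → sum (λ i → 𝔼 R (outcome b J) (seen i (Vec.map (point b) J)))) ⟩
            𝔼 R (iid R U m) (λ J → 𝔼 R (outcome b J) (unseen b J)) +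
            𝔼 R (iid R U m) (λ J → sum (λ i → 𝔼 R (outcome b J) (seen i (Vec.map (point b) J))))
              ≤⟨ +-monoʳ-≤ _ seen≤leak ⟩
            𝔼 R (iid R U m) (λ J → 𝔼 R (outcome b J) (unseen b J)) + leak ∎
            where
            D = uniformOnGraph b
            T : Subset grid
            T y = does (inSupport? D y)
            seen : Fin m → Vec (Fin N × Fin N) m → Fin N × Fin N → ℝ
            seen i S y = 𝟙 R (does (lookup S i ≟ y))
            seen≤leak :
              𝔼 R (iid R U m) (λ J → sum (λ i → 𝔼 R (outcome b J) (seen i (Vec.map (point b) J)))) ≤ leak
            seen≤leak = begin
              𝔼 R (iid R U m) (λ J → sum (λ i → 𝔼 R (outcome b J) (seen i (Vec.map (point b) J))))
                ≈⟨ 𝔼-sum (iid R U m) (λ i J → 𝔼 R (outcome b J) (seen i (Vec.map (point b) J))) ⟩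
              sum (λ i → 𝔼 R (iid R U m) (λ J → 𝔼 R (outcome b J) (seen i (Vec.map (point b) J))))
                -- Here the indices are turned back into independent samples from `D`, the form in
                -- which `Pr-outputs-entry` applies.
                ≤⟨ sum-mono (λ i → Ord.trans
                     (Ord.reflexive (ℛ.sym (𝔼-iid-map {Y = grid} (point b) U m (λ S → 𝔼 R (run M S) (seen i S)))))
                     (Pr-outputs-entry M 0≤ε dp D (uniformOnGraph≤κ b) i)) ⟩
              sum {m} (λ _ → exp ε * κ + δ)
                ≈⟨ sum-const m _ ⟩
              leak ∎

          -- For a single known `b` the algorithm could have a graph point built in, so `unseen` is
          -- small only on average. The guarantee holds for every graph and may therefore be
          -- averaged over a uniform `b`.
          success-bound : ∀ {β} → Solves R M (supportTask grid) β → 1# ≤ κ + leak + β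
          success-bound {β} solves = begin
            1#               ≈⟨ x-y+y≈x 1# β ⟨
            1# - β + β       ≤⟨ +-monoˡ-≤ β average ⟩
            κ + leak + β     ∎
            where
            average : 1# - β ≤ κ + leak
            average = begin
              1# - β
                ≤⟨ ≤-𝔼 (iid R U N) (λ b → Ord.trans (solves (uniformOnGraph b) _) (success≤ b)) ⟩
              𝔼 R (iid R U N) (λ b → 𝔼 R (iid R U m) (λ J → 𝔼 R (outcome b J) (unseen b J)) + leak)
                ≈⟨ 𝔼-+ (iid R U N) (λ b → 𝔼 R (iid R U m) (λ J → 𝔼 R (outcome b J) (unseen b J)))
                                   (λ _ → leak) ⟩
              𝔼 R (iid R U N) (λ b → 𝔼 R (iid R U m) (λ J → 𝔼 R (outcome b J) (unseen b J))) +
              𝔼 R (iid R U N) (λ _ → leak)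
                ≤⟨ +-mono-≤ 𝔼-unseen≤κ (Ord.reflexive (𝔼-const (iid R U N) leak)) ⟩
              κ + leak ∎

    -- Given `C` and `q`, first `β`, then `δ`, then `N` is fixed so that `C * β`, the `δ` part of
    -- `leak` and the terms containing `κ` are each at most 1/3, the last strictly. This contradicts
    -- `success-bound`.
    ¬PrivacyImpliesDP : ∀ P → (∀ X → PrivacyMeasure.Private P (firstEntry X)) → ¬ PrivacyImpliesDP R P
    ¬PrivacyImpliesDP P firstEntry-private (C , 0<C , q , dp-version)
      -- The arguments are the sample size 2 of `firstEntry` and the inverse of `β`, written out,
      -- for both 1/ε and 1/β. The multiple 3 yields `3# * B ≤ exp Λ` once `x₀ ≤ Λ`.
      with x₀ , 0≤x₀ , f≤exp ← polynomial-subexponential q (fromℕ 2)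
             ((fromℕ 3 * (1# + C)) ⁻¹ ⁻¹) ((fromℕ 3 * (1# + C)) ⁻¹ ⁻¹) (fromℕ 3) (fromℕ-nonneg 3) =
      refute
      where
      3# w β δ Λ B : ℝ
      3# = fromℕ 3
      -- The factor `1# + C` makes `3# * (C * β)` at most 1 and also ensures `β < 1#` for small `C`.
      w  = 3# * (1# + C)
      β  = w ⁻¹
      -- This makes log (1/δ) at least `x₀`; the additional 1 keeps `δ` below 1 even when `x₀` is 0.
      δ  = exp (x₀ + 1#) ⁻¹
      Λ  = log (δ ⁻¹)
      B  = ⟦_⟧ R q (fromℕ 2 ∷ β ⁻¹ ∷ Λ ∷ β ⁻¹ ∷ [])

      1<w : 1# < w
      1<w = begin-strict
        1#            ≈⟨ ℛ.+-identityʳ 1# ⟨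
        fromℕ 1       <⟨ fromℕ-mono-< {1} {3} (ℕ.s≤s (ℕ.s≤s ℕ.z≤n)) ⟩
        3#            ≈⟨ ℛ.*-identityʳ 3# ⟨
        3# * 1#       ≤⟨ *-monoˡ-≤ 3# (fromℕ-nonneg 3) (x≤x+y (proj₁ 0<C)) ⟩
        w             ∎

      0<w : 0# < w
      0<w = begin-strict 0# <⟨ 0<1 ⟩ 1# <⟨ 1<w ⟩ w ∎

      0<β<1 : 0# < β × β < 1#
      0<β<1 = ⁻¹-pos 0<w , ⁻¹-<1 1<w

      3Cβ≤1 : 3# * (C * β) ≤ 1#
      3Cβ≤1 = begin
        3# * (C * β) ≈⟨ ℛ.*-assoc 3# C β ⟨
        3# * C * β   ≤⟨ *-monoʳ-≤ β (proj₁ (proj₁ 0<β<1)) (*-monoˡ-≤ 3# (fromℕ-nonneg 3) (y≤x+y (0≤1 R))) ⟩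
        w * β        ≈⟨ *-inverse (0<⇒≉0 0<w) ⟩
        1#           ∎

      1<exp : 1# < exp (x₀ + 1#)
      1<exp = begin-strict
        1#               <⟨ x<x+1 1# ⟩
        1# + 1#          ≤⟨ +-monoʳ-≤ 1# (y≤x+y 0≤x₀) ⟩
        1# + (x₀ + 1#)   ≤⟨ 1+x≤exp (x₀ + 1#) ⟩
        exp (x₀ + 1#)    ∎

      0<exp : 0# < exp (x₀ + 1#)
      0<exp = begin-strict 0# <⟨ 0<1 ⟩ 1# <⟨ 1<exp ⟩ exp (x₀ + 1#) ∎

      0<δ<1 : 0# < δ × δ < 1#
      0<δ<1 = ⁻¹-pos 0<exp , ⁻¹-<1 1<exp

      exp-Λ : exp Λ ≈ δ ⁻¹
      exp-Λ = exp-log (⁻¹-pos (proj₁ 0<δ<1))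

      x₀≤Λ : x₀ ≤ Λ
      x₀≤Λ = Ord.trans (x≤x+y (0≤1 R)) (exp-cancel-≤ (+-nonneg 0≤x₀ (0≤1 R)) (begin
        exp (x₀ + 1#)                 ≈⟨ ℛ.*-identityʳ _ ⟨
        exp (x₀ + 1#) * 1#            ≈⟨ ℛ.*-congˡ (*-inverse (0<⇒≉0 (proj₁ 0<δ<1))) ⟨
        exp (x₀ + 1#) * (δ * δ ⁻¹)    ≈⟨ ℛ.*-assoc _ _ _ ⟨
        exp (x₀ + 1#) * δ * δ ⁻¹      ≈⟨ ℛ.*-congʳ (*-inverse (0<⇒≉0 0<exp)) ⟩
        1# * δ ⁻¹                     ≈⟨ ℛ.*-identityˡ _ ⟩
        δ ⁻¹                          ≈⟨ exp-Λ ⟨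
        exp Λ                         ∎))

      3Bδ≤1 : 3# * B * δ ≤ 1#
      3Bδ≤1 = begin
        3# * B * δ ≤⟨ *-monoʳ-≤ δ (proj₁ (proj₁ 0<δ<1)) (f≤exp Λ x₀≤Λ) ⟩
        exp Λ * δ  ≈⟨ ℛ.*-congʳ exp-Λ ⟩
        δ ⁻¹ * δ   ≈⟨ *-inverseˡ (proj₁ 0<δ<1) ⟩
        1#         ∎

      E : ℝ
      E = exp β

      0≤E : 0# ≤ E
      0≤E = exp-nonneg (proj₁ (proj₁ 0<β<1))

      refute : ⊥
      -- `N` is chosen from `B` rather than from `m`, because `m` is obtained only after the grid is
      -- fixed, whereas `B` depends on `C` and `q` alone. The grid has side `suc N` so as to be
      -- nonempty, and `β` doubles as the privacy parameter ε.
      refute with N , 3[1+BE]<N ← archimedean em (3# * (1# + B * E))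
        with m , m≤B , M , dp , equivalent ← dp-version (firstEntry (Grid.grid (suc N)))
               (firstEntry-private _) β δ β 0<β<1 0<δ<1 0<β<1 =
        begin-contradiction
          3#
            ≈⟨ ℛ.*-identityʳ 3# ⟨
          3# * 1#
            ≤⟨ *-monoˡ-≤ 3# (fromℕ-nonneg 3) (success-bound M (proj₁ (proj₁ 0<β<1)) dp
                 (equivalent (supportTask grid) (firstEntry-solves grid (proj₁ (proj₁ 0<β<1))))) ⟩
          3# * (κ + fromℕ m * (E * κ + δ) + C * β)
            -- Regrouping by `κ`, `δ` and `β` leaves three terms, each bounded by 1 and the first
            -- one strictly.
            ≈⟨ solve 7 (λ t k m e d c b →
                 t :* (k :+ m :* (e :* k :+ d) :+ c :* b) :=
                 k :* (t :* (con 1 :+ m :* e)) :+ (t :* m :* d :+ t :* (c :* b)))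
                 ℛ.refl 3# κ (fromℕ m) E δ C β ⟩
          κ * (3# * (1# + fromℕ m * E)) + (3# * fromℕ m * δ + 3# * (C * β))
            <⟨ +-mono-<-≤ κ-small (+-mono-≤ δ-small 3Cβ≤1) ⟩
          1# + (1# + 1#)
            ≈⟨ ℛ.+-congˡ (ℛ.+-congˡ (ℛ.+-identityʳ 1#)) ⟨
          3# ∎
        where
        open Grid (suc N)
        κ-small : κ * (3# * (1# + fromℕ m * E)) < 1#
        κ-small = begin-strict
          κ * (3# * (1# + fromℕ m * E))
            ≤⟨ *-monoˡ-≤ κ 0≤κ (*-monoˡ-≤ 3# (fromℕ-nonneg 3) (+-monoʳ-≤ 1# (*-monoʳ-≤ E 0≤E m≤B))) ⟩
          κ * (3# * (1# + B * E))
            <⟨ *-monoˡ-< κ (⁻¹-pos (fromℕ-pos (suc N))) 3[1+BE]<N ⟩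
          κ * fromℕ N
            ≤⟨ *-monoˡ-≤ κ 0≤κ (y≤x+y (0≤1 R)) ⟩
          κ * fromℕ (suc N)
            ≈⟨ *-inverseˡ (fromℕ-pos (suc N)) ⟩
          1# ∎
        δ-small : 3# * fromℕ m * δ ≤ 1#
        δ-small = begin
          3# * fromℕ m * δ ≤⟨ *-monoʳ-≤ δ (proj₁ (proj₁ 0<δ<1)) (*-monoˡ-≤ 3# (fromℕ-nonneg 3) m≤B) ⟩
          3# * B * δ       ≤⟨ 3Bδ≤1 ⟩
          1#               ∎

-- Choice of the measure for each omitted axiom.

module Separation (em : ExcludedMiddle 0ℓ) (R : RealNumbers) where
  open RealNumbers R
  open OrderedField R
  open Probability R
  open Leakage R
  open Measures R
  open LowerBound R

  module _ (A : ∀ {n} → Fin n → Set) (a : ℝ) (0≤a : 0# ≤ a) (a≤1 : a ≤ 1#) where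
    open EntryMeasure em A a 0≤a a≤1

    measure-¬PrivacyImpliesDP : A {2} 0F → ¬ PrivacyImpliesDP R measure
    measure-¬PrivacyImpliesDP A-0F = ¬PrivacyImpliesDP em measure λ X →
      Ord.trans (Ord.reflexive (μ₀-reads (firstEntry X) (ℕ.s≤s (ℕ.s≤s ℕ.z≤n) , 0F , A-0F ,
                  λ S S′ eq y → ℛ.reflexive (≡.cong (λ x → prob (dirac {X} x) y) eq))))
                a≤1

  -- Comparing through `toℕ` expresses being first uniformly in `n`, and is preserved when samples
  -- are appended.
  IsFirst IsAny : ∀ {n} → Fin n → Set
  IsFirst i = toℕ i ≡ 0
  IsAny   _ = ⊤

  module First = EntryMeasure em IsFirst 0# Ord.refl (0≤1 R)
  module Any₀  = EntryMeasure em IsAny   0# Ord.refl (0≤1 R)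
  module Any₁  = EntryMeasure em IsAny   1# (0≤1 R) Ord.refl

  first-axioms : ∀ j → j ≢ 0F → Axiom R First.measure j
  first-axioms 0F j≢0 = contradiction ≡.refl j≢0
  first-axioms 1F _   = First.noBlatantNonPrivacyᴱ
  first-axioms 2F _   = First.strongCompositionᴱ
    λ i j i≡0 j≡0 → Fin.toℕ-injective (≡.trans i≡0 (≡.sym j≡0))
  first-axioms 3F _   = First.linearScalabilityᴱ ℛ.refl
    λ r i i≡0 → ≡.trans (Fin.toℕ-↑ˡ i r) i≡0

  any₀-axioms : ∀ j → j ≢ 2F → Axiom R Any₀.measure j
  any₀-axioms 0F _   = Any₀.preprocessingᴱ _
  any₀-axioms 1F _   = Any₀.noBlatantNonPrivacyᴱ
  any₀-axioms 2F j≢2 = contradiction ≡.refl j≢2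
  any₀-axioms 3F _   = Any₀.linearScalabilityᴱ ℛ.refl _

  any₁-axioms : ∀ j → j ≢ 3F → Axiom R Any₁.measure j
  any₁-axioms 0F _   = Any₁.preprocessingᴱ _
  any₁-axioms 1F _   = Any₁.noBlatantNonPrivacyᴱ
  any₁-axioms 2F _   = Any₁.strongComposition-vacuousᴱ ℛ.refl
  any₁-axioms 3F j≢3 = contradiction ≡.refl j≢3

  separation : ∀ i → ∃[ P ] (∀ j → j ≢ i → Axiom R P j) × ¬ PrivacyImpliesDP R P
  separation 0F = First.measure , first-axioms ,
    measure-¬PrivacyImpliesDP IsFirst 0# Ord.refl (0≤1 R) ≡.refl
  separation 1F = zeroMeasure , zeroMeasure-axioms ,
    ¬PrivacyImpliesDP em zeroMeasure (λ _ → 0≤1 R)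
  separation 2F = Any₀.measure , any₀-axioms ,
    measure-¬PrivacyImpliesDP IsAny 0# Ord.refl (0≤1 R) _
  separation 3F = Any₁.measure , any₁-axioms ,
    measure-¬PrivacyImpliesDP IsAny 1# (0≤1 R) Ord.refl _

theorem3 : ExcludedMiddle (Level.suc 0ℓ) → (R : RealNumbers) →
    (i : Fin 4) → ∃[ P ] (∀ j → j ≢ i → Axiom R P j) × ¬ PrivacyImpliesDP R P
theorem3 em R = Separation.separation (map′ lower lift em) R
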